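{- Let $G$ be a finite graph and $\mathcal{VC}(G)$ the set of vertex covers of $G$. If $G$ is connected, then $T(\mathcal{VC}(G))$ is either the symmetric group or the alternating group on $\mathcal{VC}(G)$. If $G$ has components $G_1,G_2,\ldots,G_k$, then $T(\mathcal{VC}(G))\cong T(\mathcal{VC}(G_1))\times T(\mathcal{VC}(G_2))\times\cdots\times T(\mathcal{VC}(G_k))$.
   Context: A vertex cover of a graph $G$ is a subset of the vertices such that every edge of $G$ is incident to at least one vertex in the subset. $\mathcal{VC}(G)\subseteq 2^{V(G)}$, with ground set the vertex set $V(G)$. For a finite set $E$ and $\mathcal{L}\subseteq 2^E$, the toggle of $e\in E$ is the map $t_e:\mathcal{L}\to\mathcal{L}$ with $t_e(X)=X\cup\{e\}$ if $e\notin X$ and $X\cup\{e\}\in\mathcal{L}$; $t_e(X)=X\setminus\{e\}$ if $e\in X$ and $X\setminus\{e\}\in\mathcal{L}$; and $t_e(X)=X$ otherwise. The toggle group $T(\mathcal{L})$ is the subgroup of the symmetric group $\mathfrak{S}_{\mathcal{L}}$ generated by $\{t_e\mid e\in E\}$. -}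

module Defs where

open import Level using (Level; _⊔_; 0ℓ)
open import Algebra.Bundles using (Group; RawGroup)
import Algebra.Construct.DirectProduct as DirectProduct
import Algebra.Construct.Terminal as Terminal
import Algebra.Morphism.GroupMonomorphism as GroupMonomorphism
open import Algebra.Morphism.Structures using (IsGroupIsomorphism)
open import Data.Empty using (⊥-elim-irr)
open import Data.Fin.Base using (Fin; zero; suc)
open import Data.Fin.Properties using (_≟_; all?)
open import Data.Fin.Subset using (Subset; _∈_; _∉_; _⊆_; _∪_; _∩_; ⁅_⁆; _-_)
open import Data.Fin.Subset.Properties
  using (_∈?_; _⊆?_; ⊆-antisym; x∈p∪q⁻; x∈p∪q⁺; x∈p∩q⁺; x∈⁅x⁆; x∈⁅y⁆⇒x≡y;
         x∈p∧x≢y⇒x∈p-y; p─q⊆p)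
open import Data.Irrelevant using ([_])
open import Data.List.Base using (foldr; length)
open import Data.List.Relation.Unary.All using (All)
open import Data.Nat.Base using (ℕ)
open import Data.Nat.Divisibility using (_∣_)
open import Data.Product.Base using (Σ; ∃-syntax; _×_; _,_; proj₁; proj₂)
open import Data.Refinement using (Refinement; value-injective) renaming (_,_ to infixr 5 _▸_)
open import Data.Sum.Base using (_⊎_; inj₁; inj₂; [_,_]′)
open import Data.Vec.Base using (_∷_; there)
import Data.Vec.Functional as Vector
open import Function.Base using (id; case_of_)
open import Function.Bundles using (_↔_; _⇔_; Inverse; mk↔ₛ′)
open import Function.Construct.Composition using (_↔-∘_)
open import Function.Construct.Identity using (↔-id)
open import Function.Construct.Symmetry using (↔-sym)
open import Relation.Binary.Core using (Rel)
open import Relation.Binary.Construct.Closure.ReflexiveTransitive using (Star)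
open import Relation.Binary.Definitions using (Decidable; Symmetric)
open import Relation.Binary.PropositionalEquality
  using (_≡_; _≢_; refl; sym; trans; cong; subst)
open import Relation.Nullary.Decidable using (yes; no; _×-dec_; _⊎-dec_; _→-dec_)
open import Relation.Nullary.Negation using (¬_; contradiction)
import Relation.Unary as Unary
open import Relation.Unary using (Pred)

private
  variable
    c ℓ s : Level
    n : ℕ

module _ (𝒢 : Group c ℓ) where
  open Group 𝒢

  data ⟨_⟩ (S : Pred Carrier s) : Pred Carrier (c ⊔ ℓ ⊔ s) where
    gen  : ∀ {g} → S g → ⟨ S ⟩ g
    unit : ⟨ S ⟩ ε
    mul  : ∀ {g h} → ⟨ S ⟩ g → ⟨ S ⟩ h → ⟨ S ⟩ (g ∙ h)
    inv  : ∀ {g} → ⟨ S ⟩ g → ⟨ S ⟩ (g ⁻¹)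
    resp : ∀ {g h} → g ≈ h → ⟨ S ⟩ g → ⟨ S ⟩ h

  generatedSubgroup : Pred Carrier s → Group (c ⊔ ℓ ⊔ s) ℓ
  generatedSubgroup S = record
    { isGroup = GroupMonomorphism.isGroup {G₁ = raw} {G₂ = rawGroup} inclusion isGroup }
    where
    raw : RawGroup _ _
    raw = record
      { Carrier = Σ Carrier ⟨ S ⟩
      ; _≈_     = λ g h → proj₁ g ≈ proj₁ h
      ; _∙_     = λ (g , p) (h , q) → g ∙ h , mul p q
      ; ε       = ε , unit
      ; _⁻¹     = λ (g , p) → g ⁻¹ , inv p
      }
    inclusion = record
      { isGroupHomomorphism = record
        { isMonoidHomomorphism = record
          { isMagmaHomomorphism = record
            { isRelHomomorphism = record { cong = id }
            ; homo = λ _ _ → Group.refl 𝒢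
            }
          ; ε-homo = Group.refl 𝒢
          }
        ; ⁻¹-homo = λ _ → Group.refl 𝒢
        }
      ; injective = id
      }

infix 4 _≅_
_≅_ : Group c ℓ → Group c ℓ → Set (c ⊔ ℓ)
G ≅ H = ∃[ f ] IsGroupIsomorphism (Group.rawGroup G) (Group.rawGroup H) f

∏ : ∀ {k} → (Fin k → Group c ℓ) → Group c ℓ
∏ = Vector.foldr DirectProduct.group Terminal.group

-- Permutations are compared extensionally, and σ ∙ τ applies τ first.

𝔖 : Set → Group 0ℓ 0ℓ
𝔖 A = record
  { Carrier = A ↔ A
  ; _≈_     = λ σ τ → ∀ x → Inverse.to σ x ≡ Inverse.to τ x
  ; _∙_     = λ σ τ → σ ↔-∘ τ
  ; ε       = ↔-id A
  ; _⁻¹     = ↔-sym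
  ; isGroup = record
    { isMonoid = record
      { isSemigroup = record
        { isMagma = record
          { isEquivalence = record
            { refl  = λ _ → refl
            ; sym   = λ p x → sym (p x)
            ; trans = λ p q x → trans (p x) (q x)
            }
          ; ∙-cong = λ {σ} {σ′} {τ} {τ′} p q x →
              trans (cong (Inverse.to σ) (q x)) (p (Inverse.to τ′ x))
          }
        ; assoc = λ _ _ _ _ → refl
        }
      ; identity = (λ _ _ → refl) , (λ _ _ → refl)
      }
    ; inverse = Inverse.strictlyInverseʳ , Inverse.strictlyInverseˡ
    ; ⁻¹-cong = λ {σ} {τ} p x →
        trans (cong (Inverse.from σ)
                (trans (sym (Inverse.strictlyInverseˡ τ x)) (sym (p (Inverse.from τ x)))))
              (Inverse.strictlyInverseʳ σ (Inverse.from τ x))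
    }
  }

module _ {A : Set} where
  open Group (𝔖 A)

  IsTransposition : Pred (A ↔ A) 0ℓ
  IsTransposition σ =
    ∃[ a ] ∃[ b ] a ≢ b × to a ≡ b × to b ≡ a × (∀ x → x ≢ a → x ≢ b → to x ≡ x)
    where open Inverse σ using (to)

  𝔄 : Pred (A ↔ A) 0ℓ
  𝔄 σ = ∃[ τs ] All IsTransposition τs × 2 ∣ length τs × σ ≈ foldr _∙_ ε τs

-- A family 𝓛 ⊆ 2^E, where the ground set E is a finite set of labels in Fin n.
-- Decidability of membership is what makes the case split in toggles definable.

record Family {n : ℕ} (E : Subset n) : Set₁ where
  field
    Member  : Pred (Subset n) 0ℓ
    member? : Unary.Decidable Member
    within  : ∀ {X} → Member X → X ⊆ E

  -- Membership proofs are irrelevant: elements are equal when the subsets are.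
  Element : Set
  Element = Refinement (Subset n) Member

x∉p-x : (p : Subset n) (x : Fin n) → x ∉ p - x
x∉p-x (_ ∷ p) zero    ()
x∉p-x (_ ∷ p) (suc x) (there q) = x∉p-x p x q

add-remove : {X : Subset n} {e : Fin n} → e ∉ X → (X ∪ ⁅ e ⁆) - e ≡ X
add-remove {X = X} {e} e∉X = ⊆-antisym
  (λ x∈ → [ id , (λ x∈e → contradiction
                   (subst (_∈ (X ∪ ⁅ e ⁆) - e) (x∈⁅y⁆⇒x≡y _ x∈e) x∈)
                   (x∉p-x (X ∪ ⁅ e ⁆) e)) ]′
          (x∈p∪q⁻ X ⁅ e ⁆ (p─q⊆p (X ∪ ⁅ e ⁆) ⁅ e ⁆ x∈)))
  (λ x∈X → x∈p∧x≢y⇒x∈p-y (x∈p∪q⁺ (inj₁ x∈X)) (λ x≡e → e∉X (subst (_∈ X) x≡e x∈X)))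

remove-add : {X : Subset n} {e : Fin n} → e ∈ X → (X - e) ∪ ⁅ e ⁆ ≡ X
remove-add {X = X} {e} e∈X = ⊆-antisym
  (λ x∈ → [ p─q⊆p X ⁅ e ⁆ , (λ x∈e → subst (_∈ X) (sym (x∈⁅y⁆⇒x≡y _ x∈e)) e∈X) ]′
          (x∈p∪q⁻ (X - e) ⁅ e ⁆ x∈))
  back
  where
  back : X ⊆ (X - e) ∪ ⁅ e ⁆
  back {x} x∈X with x ≟ e
  ... | yes x≡e = x∈p∪q⁺ (inj₂ (subst (_∈ ⁅ e ⁆) (sym x≡e) (x∈⁅x⁆ e)))
  ... | no  x≢e = x∈p∪q⁺ (inj₁ (x∈p∧x≢y⇒x∈p-y x∈X x≢e))

module _ {E : Subset n} (𝓛 : Family E) where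
  open Family 𝓛

  toggle : Fin n → Element → Element
  toggle e (X ▸ p) with e ∈? X
  ... | no  _ with member? (X ∪ ⁅ e ⁆)
  ...   | yes q = (X ∪ ⁅ e ⁆) ▸ [ q ]
  ...   | no  _ = X ▸ p
  toggle e (X ▸ p) | yes _ with member? (X - e)
  ...   | yes q = (X - e) ▸ [ q ]
  ...   | no  _ = X ▸ p

  module _ {e : Fin n} {X : Subset n} .(p : Member X) where

    toggle-add : e ∉ X → .(q : Member (X ∪ ⁅ e ⁆)) →
                 toggle e (X ▸ [ p ]) ≡ (X ∪ ⁅ e ⁆) ▸ [ q ]
    toggle-add e∉X q with e ∈? X
    ... | yes e∈X = contradiction e∈X e∉X
    ... | no  _ with member? (X ∪ ⁅ e ⁆)
    ...   | yes _ = refl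
    ...   | no ¬q = ⊥-elim-irr (¬q q)

    toggle-add-fix : e ∉ X → ¬ Member (X ∪ ⁅ e ⁆) → toggle e (X ▸ [ p ]) ≡ X ▸ [ p ]
    toggle-add-fix e∉X ¬q with e ∈? X
    ... | yes e∈X = contradiction e∈X e∉X
    ... | no  _ with member? (X ∪ ⁅ e ⁆)
    ...   | yes q = contradiction q ¬q
    ...   | no  _ = refl

    toggle-remove : e ∈ X → .(q : Member (X - e)) →
                    toggle e (X ▸ [ p ]) ≡ (X - e) ▸ [ q ]
    toggle-remove e∈X q with e ∈? X
    ... | no e∉X = contradiction e∈X e∉X
    ... | yes _ with member? (X - e)
    ...   | yes _ = refl
    ...   | no ¬q = ⊥-elim-irr (¬q q)

    toggle-remove-fix : e ∈ X → ¬ Member (X - e) → toggle e (X ▸ [ p ]) ≡ X ▸ [ p ]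
    toggle-remove-fix e∈X ¬q with e ∈? X
    ... | no e∉X = contradiction e∈X e∉X
    ... | yes _ with member? (X - e)
    ...   | yes q = contradiction q ¬q
    ...   | no  _ = refl

  toggle-involutive : ∀ e (x : Element) → toggle e (toggle e x) ≡ x
  toggle-involutive e (X ▸ [ p ]) = case e ∈? X of λ where
    (no e∉X) → case member? (X ∪ ⁅ e ⁆) of λ where
      (yes q) → trans (cong (toggle e) (toggle-add p e∉X q))
        (trans (toggle-remove q (x∈p∪q⁺ (inj₂ (x∈⁅x⁆ e)))
                 (subst Member (sym (add-remove e∉X)) p))
               (value-injective (add-remove e∉X)))
      (no ¬q) → trans (cong (toggle e) (toggle-add-fix p e∉X ¬q)) (toggle-add-fix p e∉X ¬q)
    (yes e∈X) → case member? (X - e) of λ where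
      (yes q) → trans (cong (toggle e) (toggle-remove p e∈X q))
        (trans (toggle-add q (x∉p-x X e) (subst Member (sym (remove-add e∈X)) p))
               (value-injective (remove-add e∈X)))
      (no ¬q) → trans (cong (toggle e) (toggle-remove-fix p e∈X ¬q)) (toggle-remove-fix p e∈X ¬q)

  t : Fin n → Element ↔ Element
  t e = mk↔ₛ′ (toggle e) (toggle e) (toggle-involutive e) (toggle-involutive e)

  IsToggle : Pred (Element ↔ Element) 0ℓ
  IsToggle σ = ∃[ e ] e ∈ E × σ ≡ t e

  -- T as a set of permutations, for comparison with other subgroups of 𝔖 Element.
  InT : Pred (Element ↔ Element) 0ℓ
  InT = ⟨ 𝔖 Element ⟩ IsToggle

  T : Group 0ℓ 0ℓ
  T = generatedSubgroup (𝔖 Element) IsToggle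

-- A finite simple graph: its vertices are a finite set of labels in Fin n,
-- not necessarily all of Fin n, so that G and its components share labels.
-- Loops must be excluded: a looped vertex lies in every vertex cover.

record Graph (n : ℕ) : Set₁ where
  infix 4 _~_ _~?_
  field
    V        : Subset n
    _~_      : Rel (Fin n) 0ℓ
    _~?_     : Decidable _~_
    ~-sym    : Symmetric _~_
    ~-irrefl : ∀ {u} → ¬ (u ~ u)
    ~⇒∈V     : ∀ {u v} → u ~ v → u ∈ V

  IsVertexCover : Pred (Subset n) 0ℓ
  IsVertexCover X = X ⊆ V × (∀ u v → u ~ v → u ∈ X ⊎ v ∈ X)

  isVertexCover? : Unary.Decidable IsVertexCover
  isVertexCover? X =
    X ⊆? V ×-dec all? λ u → all? λ v → (u ~? v) →-dec (u ∈? X ⊎-dec v ∈? X)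

  𝒱𝒞 : Family V
  𝒱𝒞 = record { Member = IsVertexCover ; member? = isVertexCover? ; within = proj₁ }

  -- Star _~_ u v is the existence of a walk from u to v.  The graph without
  -- vertices counts as connected here.
  Connected : Set
  Connected = ∀ {u v} → u ∈ V → v ∈ V → Star _~_ u v

  IsComponent : Pred (Subset n) 0ℓ
  IsComponent C = ∃[ v ] v ∈ V × (∀ u → u ∈ C ⇔ Star _~_ v u)

open Graph public using (Connected; IsComponent; 𝒱𝒞)

infix 8 _⟦_⟧
_⟦_⟧ : Graph n → Subset n → Graph n
G ⟦ C ⟧ = record
  { V        = V ∩ C
  ; _~_      = λ u v → u ~ v × u ∈ C × v ∈ C
  ; _~?_     = λ u v → u ~? v ×-dec u ∈? C ×-dec v ∈? C
  ; ~-sym    = λ (u~v , u∈C , v∈C) → ~-sym u~v , v∈C , u∈C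
  ; ~-irrefl = λ (u~u , _) → ~-irrefl u~u
  ; ~⇒∈V     = λ (u~v , u∈C , _) → x∈p∩q⁺ (~⇒∈V u~v , u∈C)
  }
  where open Graph G

-- C enumerates the vertex sets of the components of G, each exactly once.

record Components (G : Graph n) {k : ℕ} (C : Fin k → Subset n) : Set where
  field
    isComponent : ∀ i → IsComponent G (C i)
    distinct    : ∀ {i j} → C i ≡ C j → i ≡ j
    complete    : ∀ {D} → IsComponent G D → ∃[ i ] D ≡ C i

{-# OPTIONS --safe #-}
module Submission where

-- Connected case.  Say a ≈ b when a = b or some 3-cycle of the toggle group T moves a to b;
-- this is an equivalence relation preserved by T.  If V ∖ {x} ≈ V and y ~ x, then toggling y,
-- which fixes V ∖ {x}, gives V ∖ {y} ≈ V.  So by connectedness a single 3-cycle through V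
-- and some V ∖ {w} makes all covers equivalent, and T then contains every 3-cycle.  Such a
-- 3-cycle is carried from a set S of vertices to S ∪ {v}, where v is adjacent to some w ∈ S:
-- if g acts as (V, V ∖ {w}, V ∖ {u}) on the covers containing V ∖ S, for an edge u ~ w in S,
-- then [t_w, g] does so on those containing V ∖ (S ∪ {v}), because t_w is trivial on the
-- covers avoiding v.  As T contains all 3-cycles it contains the alternating group, and the
-- parities of the toggles decide between the two groups.
--
-- Components.  X ↦ X ∩ C_i commutes with the toggles at vertices of C_i and is invariant under
-- all others, so it induces T(𝒱𝒞(G)) → T(𝒱𝒞(G_i)); jointly these are bijective because X is
-- the disjoint union of the X ∩ C_i and each toggle of G_i lifts to one of G.

open import Defs
open import Level using (Level; 0ℓ)
open import Algebra.Bundles using (Group)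
open import Algebra.Morphism.Structures using (IsGroupHomomorphism)
open import Algebra.Properties.Group using (//-rightDividesˡ)
open import Data.Bool.Base using (Bool; true; false; not; _∧_)
import Data.Bool.Properties as Bool
open import Data.Fin.Base using (Fin; zero; suc)
import Data.Fin.Properties as Fin
open import Data.Fin.Subset
  using (Subset; inside; outside; _∈_; _∉_; _⊆_; _∪_; _∩_; ∁; ⁅_⁆; _-_)
open import Data.Fin.Subset.Properties
  using (_∈?_; ⊆-antisym; p─q⊆p; x∈p∧x≢y⇒x∈p-y; x∈p∪q⁺; x∈p∪q⁻; x∈p∩q⁺; x∈p∩q⁻; x∈⁅x⁆; x∈⁅y⁆⇒x≡y;
         x∈∁p⇒x∉p; x∉p⇒x∈∁p)
open import Data.Irrelevant using ([_])
open import Data.List.Base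
  using (List; []; _∷_; _++_; foldr; length; map; allFin; cartesianProductWith)
open import Data.List.Membership.Propositional using () renaming (_∈_ to _∈ˡ_)
open import Data.List.Membership.Propositional.Properties
  using (∈-allFin; ∈-map⁺; ∈-cartesianProductWith⁺)
open import Data.List.Properties using (length-++)
import Data.List.Relation.Unary.All as All
open import Data.List.Relation.Unary.All using (All; []; _∷_)
open import Data.List.Relation.Unary.All.Properties using (++⁺)
import Data.List.Relation.Unary.Any as Any
open import Data.List.Relation.Unary.Any using (here; there)
open import Data.Nat.Base using (ℕ; zero; suc; s≤s)
open import Data.Nat.Divisibility using (_∣_; ∣m∣n⇒∣m+n; ∣m+n∣m⇒∣n; ∣-refl; _∣0; ∣⇒≤)
open import Data.Nat.Properties using (+-suc; +-comm)
open import Data.Product.Base using (∃-syntax; _×_; _,_; proj₁; proj₂)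
open import Data.Refinement using (Refinement; value; value-injective) renaming (_,_ to infixr 5 _▸_)
import Data.Refinement as Refinement
open import Data.Sum.Base using (_⊎_; inj₁; inj₂; [_,_]′)
open import Data.Unit.Base using (⊤; tt)
open import Data.Vec.Base using ([]; _∷_; lookup; tabulate)
open import Data.Vec.Properties
  using ([]=⇒lookup; lookup⇒[]=; lookup-zipWith; lookup∘tabulate; ≡-dec)
open import Data.Vec.Relation.Binary.Pointwise.Extensional using (ext; Pointwise-≡⇒≡)
open import Effect.Monad using (RawMonad)
open import Function.Base using (_∘_; id; case_of_)
open import Function.Bundles using (_↔_; _⇔_; Inverse; Equivalence; mk↔ₛ′; mk⇔)
import Relation.Binary.Construct.Closure.ReflexiveTransitive as Star
open import Relation.Binary.Construct.Closure.ReflexiveTransitive using (Star; _◅_; _◅◅_)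
open import Relation.Binary.Definitions using (DecidableEquality)
open import Relation.Binary.PropositionalEquality
  using (_≡_; _≢_; refl; sym; trans; cong; subst; ≢-sym)
open import Relation.Nullary.Decidable
  using (Dec; yes; no; does; dec-true; recompute; ¬¬-excluded-middle; _→-dec_)
open import Relation.Nullary.Negation using (¬_; contradiction; ¬¬-Monad)
open import Relation.Unary using (Pred; U; _≐_) renaming (_⊆_ to _⋐_)

open Inverse using (to; from; strictlyInverseˡ; strictlyInverseʳ)

private
  variable
    a ℓ : Level
    k n : ℕ

-- Three-cycles and transpositions

from-≡ : ∀ {A : Set} (g : A ↔ A) {a b} → to g a ≡ b → from g b ≡ a
from-≡ g {a} p = trans (cong (from g) (sym p)) (strictlyInverseʳ g a)

to-≡ : ∀ {A : Set} (g : A ↔ A) {a b} → from g a ≡ b → to g b ≡ a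
to-≡ g {a} p = trans (cong (to g) (sym p)) (strictlyInverseˡ g a)

-- Outside `D` the action of `g` is left open. This matters because a permutation built from few
-- toggles is controlled only on the covers that are full elsewhere. If two of `a`, `b`, `c`
-- coincide, the first three fields force all three to be equal.
record Rotates {A : Set} (D : Pred A 0ℓ) (g : A ↔ A) (a b c : A) : Set where
  field
    a↦b   : to g a ≡ b
    b↦c   : to g b ≡ c
    c↦a   : to g c ≡ a
    fixes : ∀ {x} → D x → x ≢ a → x ≢ b → x ≢ c → to g x ≡ x

open Rotates

module ThreeCycles {A : Set} (_≟_ : DecidableEquality A)
  (S : Pred (A ↔ A) 0ℓ) (D : Pred A 0ℓ)
  (D-closed : ∀ {g} → ⟨ 𝔖 A ⟩ S g → ∀ {x} → D x → D (to g x))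
  where

  open Group (𝔖 A) using (_∙_; _⁻¹)

  Cycle : A → A → A → Set
  Cycle a b c = ∃[ g ] ⟨ 𝔖 A ⟩ S g × Rotates D g a b c

  rotate : ∀ {a b c} → Cycle a b c → Cycle b c a
  rotate (g , g∈ , r) = g , g∈ , record
    { a↦b = b↦c r ; b↦c = c↦a r ; c↦a = a↦b r
    ; fixes = λ d x≢b x≢c x≢a → fixes r d x≢a x≢b x≢c }

  reverse : ∀ {a b c} → Cycle a b c → Cycle b a c
  reverse (g , g∈ , r) = g ⁻¹ , inv g∈ , record
    { a↦b = from-≡ g (a↦b r) ; b↦c = from-≡ g (c↦a r) ; c↦a = from-≡ g (b↦c r)
    ; fixes = λ d x≢b x≢a x≢c → from-≡ g (fixes r d x≢a x≢b x≢c) }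

  conjugate : ∀ {h a b c} → ⟨ 𝔖 A ⟩ S h → Cycle a b c → Cycle (to h a) (to h b) (to h c)
  conjugate {h} h∈ (g , g∈ , r) = h ∙ (g ∙ h ⁻¹) , mul h∈ (mul g∈ (inv h∈)) , record
    { a↦b = move (a↦b r) ; b↦c = move (b↦c r) ; c↦a = move (c↦a r)
    ; fixes = λ {x} d x≢a x≢b x≢c → to-≡ h (sym (fixes r (D-closed (inv h∈) d)
        (x≢a ∘ sym ∘ to-≡ h) (x≢b ∘ sym ∘ to-≡ h) (x≢c ∘ sym ∘ to-≡ h))) }
    where
    move : ∀ {x y} → to g x ≡ y → to h (to g (from h (to h x))) ≡ to h y
    move {x} p = cong (to h) (trans (cong (to g) (strictlyInverseʳ h x)) p)

  cycle-≡ : ∀ {a a′ b b′ c c′} → a ≡ a′ → b ≡ b′ → c ≡ c′ → Cycle a b c → Cycle a′ b′ c′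
  cycle-≡ refl refl refl z = z

  infix 4 _≈_
  _≈_ : A → A → Set
  a ≈ b = a ≡ b ⊎ ∃[ c ] Cycle a b c

  ≈-sym : ∀ {a b} → a ≈ b → b ≈ a
  ≈-sym (inj₁ a≡b)     = inj₁ (sym a≡b)
  ≈-sym (inj₂ (c , z)) = inj₂ (c , reverse z)

  -- If `a` is not on the second cycle (b c e), conjugating (a b d) by it fixes `a` and moves `b` to
  -- `c`. If `a` is `b` or `e`, then (b c e) or its inverse already takes `a` to `c`.
  ≈-trans : ∀ {a b c} → D a → a ≈ b → b ≈ c → a ≈ c
  ≈-trans _ (inj₁ refl) q = q
  ≈-trans _ p (inj₁ refl) = p
  ≈-trans {a} {b} {c} a∈D (inj₂ (d , z)) (inj₂ (e , y@(h , h∈ , r)))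
    with a ≟ c | a ≟ b | a ≟ e
  ... | yes a≡c | _ | _ = inj₁ a≡c
  ... | no _ | yes refl | _ = inj₂ (e , y)
  ... | no _ | no _ | yes refl = inj₂ (b , reverse (rotate y))
  ... | no a≢c | no a≢b | no a≢e =
    inj₂ (to h d , cycle-≡ (fixes r a∈D a≢b a≢c a≢e) (a↦b r) refl (conjugate h∈ z))

  ≈-cong : ∀ {h a b} → ⟨ 𝔖 A ⟩ S h → a ≈ b → to h a ≈ to h b
  ≈-cong h∈ (inj₁ refl)    = inj₁ refl
  ≈-cong h∈ (inj₂ (c , z)) = inj₂ (_ , conjugate h∈ z)

  -- Conjugating (a b d) by the 3-cycle (d c e) gives (a b c) unless e is a or b; then
  -- conjugating by its inverse gives (c b a) or (a c b).
  cycle-to : ∀ {a b c d} → D a → D b → a ≢ b → b ≢ c → c ≢ a → Cycle a b d → d ≈ c → Cycle a b c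
  cycle-to _ _ _ _ _ z (inj₁ refl) = z
  cycle-to {a} {b} {c} {d} a∈D b∈D a≢b b≢c c≢a z@(g , _ , s) (inj₂ (e , h , h∈ , r))
    with e ≟ a | e ≟ b
  ... | yes refl | _ = rotate (rotate (reverse (cycle-≡
          (from-≡ h (b↦c r)) b-fixed (from-≡ h (c↦a r)) (conjugate (inv h∈) z))))
    where
    d≢b : b ≢ d
    d≢b refl = a≢b (trans (sym (c↦a s)) (b↦c s))
    b-fixed : from h b ≡ b
    b-fixed = from-≡ h (fixes r b∈D d≢b b≢c (≢-sym a≢b))
  ... | no _ | yes refl = rotate (reverse (cycle-≡
          a-fixed (from-≡ h (b↦c r)) (from-≡ h (c↦a r)) (conjugate (inv h∈) z)))
    where
    a≢d : a ≢ d
    a≢d refl = a≢b (trans (sym (c↦a s)) (a↦b s))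
    a-fixed : from h a ≡ a
    a-fixed = from-≡ h (fixes r a∈D a≢d (≢-sym c≢a) a≢b)
  ... | no e≢a | no e≢b = cycle-≡
          (fixes r a∈D a≢d (≢-sym c≢a) (≢-sym e≢a)) (fixes r b∈D b≢d b≢c (≢-sym e≢b)) (a↦b r)
          (conjugate h∈ z)
    where
    a≢d : a ≢ d
    a≢d refl = a≢b (trans (sym (c↦a s)) (a↦b s))
    b≢d : b ≢ d
    b≢d refl = a≢b (trans (sym (c↦a s)) (b↦c s))

  -- The equivalence of `a` and `b` yields a 3-cycle (a b d) with some third point `d`, and
  -- `cycle-to` exchanges `d` for the equivalent point `c`.
  all-cycles : (∀ {x y} → D x → D y → x ≈ y) →
    ∀ {a b c} → D a → D b → D c → a ≢ b → b ≢ c → c ≢ a → Cycle a b c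
  all-cycles connected {a} {b} {c} a∈D b∈D c∈D a≢b b≢c c≢a with connected a∈D b∈D
  ... | inj₁ a≡b = contradiction a≡b a≢b
  ... | inj₂ (d , z@(g , g∈ , r)) = cycle-to a∈D b∈D a≢b b≢c c≢a z
          (connected (subst D (b↦c r) (D-closed g∈ b∈D)) c∈D)

  -- With `s` acting as (a b) and `g` as (a b c) on these points, the commutator of `s` and `g` is
  -- (a b c) again. At any other point one of the two acts trivially where it is applied, so the
  -- other cancels against its inverse.
  commutator : ∀ {s a b c g} → ⟨ 𝔖 A ⟩ S s → to s a ≡ b → to s b ≡ a → to s c ≡ c →
    ⟨ 𝔖 A ⟩ S g → to g a ≡ b → to g b ≡ c → to g c ≡ a →
    (∀ {x} → D x → x ≢ a → x ≢ b → x ≢ c →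
      (to g x ≡ x × to g (from s x) ≡ from s x) ⊎ (to s x ≡ x × to s (from g x) ≡ from g x)) →
    Cycle a b c
  commutator {s} {a} {b} {c} {g} s∈ sa sb sc g∈ ga gb gc elsewhere =
    s ∙ (g ∙ (s ⁻¹ ∙ g ⁻¹)) , mul s∈ (mul g∈ (mul (inv s∈) (inv g∈))) , record
    { a↦b = chain (from-≡ g gc) (from-≡ s sc) gc sa
    ; b↦c = chain (from-≡ g ga) (from-≡ s sb) gb sc
    ; c↦a = chain (from-≡ g gb) (from-≡ s sa) ga sb
    ; fixes = λ {x} x∈D x≢a x≢b x≢c → undisturbed (elsewhere x∈D x≢a x≢b x≢c)
    }
    where
    chain : ∀ {x y z v w} → from g x ≡ y → from s y ≡ z → to g z ≡ v → to s v ≡ w →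
            to s (to g (from s (from g x))) ≡ w
    chain refl refl refl p = p
    undisturbed : ∀ {x} →
      (to g x ≡ x × to g (from s x) ≡ from s x) ⊎ (to s x ≡ x × to s (from g x) ≡ from g x) →
      to s (to g (from s (from g x))) ≡ x
    undisturbed {x} (inj₁ (gx , gs⁻¹x)) = chain (from-≡ g gx) refl gs⁻¹x (strictlyInverseˡ s x)
    undisturbed {x} (inj₂ (sx , sg⁻¹x)) = chain refl (from-≡ s sg⁻¹x) (strictlyInverseˡ g x) sx

-- Factorisation into transpositions and parity

module _ {A : Set} (_≟_ : DecidableEquality A) where

  open Group (𝔖 A) using (_≈_; _∙_; _⁻¹; ε)

  transpose : A → A → A → A
  transpose a b x with x ≟ a | x ≟ b
  ... | yes _ | _     = b
  ... | no _  | yes _ = a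
  ... | no _  | no _  = x

  transpose-left : ∀ a b → transpose a b a ≡ b
  transpose-left a b with a ≟ a
  ... | yes _  = refl
  ... | no a≢a = contradiction refl a≢a

  transpose-right : ∀ a b → transpose a b b ≡ a
  transpose-right a b with b ≟ a | b ≟ b
  ... | yes b≡a | _      = b≡a
  ... | no _    | yes _  = refl
  ... | no _    | no b≢b = contradiction refl b≢b

  transpose-other : ∀ {a b x} → x ≢ a → x ≢ b → transpose a b x ≡ x
  transpose-other {a} {b} {x} x≢a x≢b with x ≟ a | x ≟ b
  ... | yes x≡a | _       = contradiction x≡a x≢a
  ... | no _    | yes x≡b = contradiction x≡b x≢b
  ... | no _    | no _    = refl

  transpose-involutive : ∀ a b x → transpose a b (transpose a b x) ≡ x
  transpose-involutive a b x with x ≟ a | x ≟ b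
  ... | yes refl | _        = transpose-right a b
  ... | no _     | yes refl = transpose-left a b
  ... | no x≢a   | no x≢b   = transpose-other x≢a x≢b

  transposition : A → A → A ↔ A
  transposition a b = mk↔ₛ′ (transpose a b) (transpose a b)
                            (transpose-involutive a b) (transpose-involutive a b)

  transposition-isTransposition : ∀ {a b} → a ≢ b → IsTransposition (transposition a b)
  transposition-isTransposition {a} {b} a≢b =
    a , b , a≢b , transpose-left a b , transpose-right a b , λ _ → transpose-other

  private
    ∏τ : List (A ↔ A) → A ↔ A
    ∏τ = foldr _∙_ ε

  product-++ : ∀ τs {υs} → ∏τ (τs ++ υs) ≈ ∏τ τs ∙ ∏τ υs
  product-++ []       x = refl
  product-++ (τ ∷ τs) x = cong (to τ) (product-++ τs x)

  product-⁻¹ : ∀ {τs} → All IsTransposition τs →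
    ∃[ υs ] All IsTransposition υs × length υs ≡ length τs × ∏τ τs ⁻¹ ≈ ∏τ υs
  product-⁻¹ [] = [] , [] , refl , λ _ → refl
  product-⁻¹ {τ ∷ τs} ((a , b , a≢b , τa , τb , τx) ∷ ts) with product-⁻¹ ts
  ... | υs , us , ∣υs∣ , eq =
    υs ++ τ ⁻¹ ∷ [] ,
    ++⁺ us ((a , b , a≢b , from-≡ τ τb , from-≡ τ τa , λ x x≢a x≢b → from-≡ τ (τx x x≢a x≢b)) ∷ []) ,
    trans (length-++ υs) (trans (+-comm (length υs) 1) (cong suc ∣υs∣)) ,
    λ x → trans (eq (from τ x)) (sym (product-++ υs x))

  -- Multiplying by the transposition of y and σ y fixes y and moves no new point.
  factor : ∀ xs (σ : A ↔ A) → (∀ x → to σ x ≡ x ⊎ x ∈ˡ xs) →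
    ∃[ τs ] All IsTransposition τs × σ ≈ ∏τ τs
  factor [] σ moved = [] , [] , λ x → fixed (moved x)
    where
    fixed : ∀ {x} → to σ x ≡ x ⊎ x ∈ˡ [] → to σ x ≡ x
    fixed (inj₁ σx) = σx
  factor (y ∷ ys) σ moved with to σ y ≟ y
  ... | yes σy = factor ys σ λ x → tail (moved x)
    where
    tail : ∀ {x} → to σ x ≡ x ⊎ x ∈ˡ (y ∷ ys) → to σ x ≡ x ⊎ x ∈ˡ ys
    tail (inj₁ σx)           = inj₁ σx
    tail (inj₂ (here refl))  = inj₁ σy
    tail (inj₂ (there x∈ys)) = inj₂ x∈ys
  ... | no σy≢y with factor ys (transposition y (to σ y) ∙ σ) (λ x → tail (moved x))
    where
    tail : ∀ {x} → to σ x ≡ x ⊎ x ∈ˡ (y ∷ ys) →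
           transpose y (to σ y) (to σ x) ≡ x ⊎ x ∈ˡ ys
    tail (inj₂ (here refl))  = inj₁ (transpose-right y (to σ y))
    tail (inj₂ (there x∈ys)) = inj₂ x∈ys
    tail {x} (inj₁ σx) with x ≟ y
    ... | yes refl = contradiction σx σy≢y
    ... | no x≢y   = inj₁ (trans (cong (transpose y (to σ y)) σx) (transpose-other x≢y
          λ x≡σy → x≢y (trans (sym (from-≡ σ σx)) (from-≡ σ (sym x≡σy)))))
  ...   | τs , ts , eq = transposition y (to σ y) ∷ τs ,
    transposition-isTransposition (σy≢y ∘ sym) ∷ ts ,
    λ x → trans (sym (transpose-involutive y (to σ y) (to σ x))) (cong (transpose y (to σ y)) (eq x))

  2∣2+n⇒2∣n : ∀ {n} → 2 ∣ suc (suc n) → 2 ∣ n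
  2∣2+n⇒2∣n p = ∣m+n∣m⇒∣n p ∣-refl

  parity : ∀ n → 2 ∣ n ⊎ 2 ∣ suc n
  parity zero    = inj₁ (2 ∣0)
  parity (suc n) = [ inj₂ ∘ ∣m∣n⇒∣m+n ∣-refl , inj₁ ]′ (parity n)

  -- Parity is that of one chosen factorisation; no sign homomorphism is defined.
  Odd : Pred (A ↔ A) 0ℓ
  Odd σ = ∃[ τs ] All IsTransposition τs × 2 ∣ suc (length τs) × σ ≈ ∏τ τs

  even⊎odd : ∀ xs → (∀ x → x ∈ˡ xs) → ∀ σ → 𝔄 σ ⊎ Odd σ
  even⊎odd xs listed σ with factor xs σ (inj₂ ∘ listed)
  ... | τs , ts , eq = [ (λ p → inj₁ (τs , ts , p , eq)) , (λ p → inj₂ (τs , ts , p , eq)) ]′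
    (parity (length τs))

  -- Groups containing all 3-cycles

  module _ (S : Pred (A ↔ A) 0ℓ) where
    open ThreeCycles _≟_ S (λ _ → ⊤) (λ _ _ → tt) using (Cycle)

    module _ (cycle : ∀ {a b c} → a ≢ b → b ≢ c → c ≢ a → Cycle a b c) where

      -- With `τ` applied first, (a b)(b c) is the 3-cycle (a b c), or the identity when `c` is `a`.
      linked-pair : ∀ {σ τ a b c} → a ≢ b → b ≢ c →
        to σ a ≡ b → to σ b ≡ a → (∀ x → x ≢ a → x ≢ b → to σ x ≡ x) →
        to τ b ≡ c → to τ c ≡ b → (∀ x → x ≢ b → x ≢ c → to τ x ≡ x) →
        ⟨ 𝔖 A ⟩ S (σ ∙ τ)
      linked-pair {σ} {τ} {a} {b} {c} a≢b b≢c σa σb σx τb τc τx with c ≟ a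
      ... | yes refl = resp involutive unit
        where
        involutive : ε ≈ σ ∙ τ
        involutive x with x ≟ a | x ≟ b
        ... | yes refl | _        = sym (trans (cong (to σ) τc) σb)
        ... | no _     | yes refl = sym (trans (cong (to σ) τb) σa)
        ... | no x≢a   | no x≢b   = sym (trans (cong (to σ) (τx x x≢b x≢a)) (σx x x≢a x≢b))
      ... | no c≢a with cycle a≢b b≢c c≢a
      ...   | g , g∈ , r = resp agree g∈
        where
        agree : g ≈ σ ∙ τ
        agree x with x ≟ a | x ≟ b | x ≟ c
        ... | yes refl | _ | _ = trans (a↦b r) (sym (trans (cong (to σ) (τx a a≢b (c≢a ∘ sym))) σa))
        ... | no _ | yes refl | _ = trans (b↦c r) (sym (trans (cong (to σ) τb) (σx c c≢a (b≢c ∘ sym))))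
        ... | no _ | no _ | yes refl = trans (c↦a r) (sym (trans (cong (to σ) τc) σb))
        ... | no x≢a | no x≢b | no x≢c = trans (fixes r tt x≢a x≢b x≢c)
              (sym (trans (cong (to σ) (τx x x≢b x≢c)) (σx x x≢a x≢b)))

      -- (a b)(c d) = (a b)(b c) · (b c)(c d)
      transposition-pair : ∀ {σ τ} → IsTransposition σ → IsTransposition τ → ⟨ 𝔖 A ⟩ S (σ ∙ τ)
      transposition-pair {σ} {τ} (a , b , a≢b , σa , σb , σx) (c , d , c≢d , τc , τd , τx) with b ≟ c
      ... | yes refl = linked-pair {σ} {τ} a≢b c≢d σa σb σx τc τd τx
      ... | no b≢c   = resp (λ x → cong (to σ) (transpose-involutive b c (to τ x))) (mul
        (linked-pair {σ} {β} a≢b b≢c σa σb σx βb βc (λ _ → transpose-other))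
        (linked-pair {β} {τ} b≢c c≢d βb βc (λ _ → transpose-other) τc τd τx))
        where
        β : A ↔ A
        β = transposition b c
        βb : transpose b c b ≡ c
        βb = transpose-left b c
        βc : transpose b c c ≡ b
        βc = transpose-right b c

      even-product : ∀ {τs} → All IsTransposition τs → 2 ∣ length τs → ⟨ 𝔖 A ⟩ S (∏τ τs)
      even-product []             _ = unit
      even-product (_ ∷ [])       p = contradiction (∣⇒≤ p) λ { (s≤s ()) }
      even-product {σ ∷ τ ∷ τs} (s ∷ t ∷ ts) p =
        resp (λ _ → refl) (mul (transposition-pair {σ} {τ} s t) (even-product ts (2∣2+n⇒2∣n p)))

      𝔄⊆generated : ∀ {σ} → 𝔄 σ → ⟨ 𝔖 A ⟩ S σ
      𝔄⊆generated (τs , ts , p , eq) = resp (sym ∘ eq) (even-product ts p)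

      generated⊆𝔄 : (∀ {σ} → S σ → 𝔄 σ) → ∀ {σ} → ⟨ 𝔖 A ⟩ S σ → 𝔄 σ
      generated⊆𝔄 even (gen s) = even s
      generated⊆𝔄 even unit = [] , [] , 2 ∣0 , λ _ → refl
      generated⊆𝔄 even (mul {g} p q) with generated⊆𝔄 even p | generated⊆𝔄 even q
      ... | τs , ts , 2∣τs , eq | υs , us , 2∣υs , eq′ =
        τs ++ υs , ++⁺ ts us , subst (2 ∣_) (sym (length-++ τs)) (∣m∣n⇒∣m+n 2∣τs 2∣υs) ,
        λ x → trans (cong (to g) (eq′ x)) (trans (eq _) (sym (product-++ τs x)))
      generated⊆𝔄 even (inv {g} p) with generated⊆𝔄 even p
      ... | τs , ts , 2∣τs , eq with product-⁻¹ ts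
      ...   | υs , us , ∣υs∣ , eq′ = υs , us , subst (2 ∣_) (sym ∣υs∣) 2∣τs ,
        λ x → trans (from-≡ g (trans (eq _) (strictlyInverseˡ (∏τ τs) x))) (eq′ x)
      generated⊆𝔄 even (resp g≈h p) with generated⊆𝔄 even p
      ... | τs , ts , 2∣τs , eq = τs , ts , 2∣τs , λ x → trans (sym (g≈h x)) (eq x)

      module _ (xs : List A) (listed : ∀ x → x ∈ˡ xs) where

        -- For `σ` odd, `σ ∙ τ` is even and hence generated; then `σ` is recovered by multiplying
        -- with the inverse of `τ`.
        odd-generates : ∀ {τ} → S τ → Odd τ → ∀ σ → ⟨ 𝔖 A ⟩ S σ
        odd-generates {τ} s (υs , us , 2∣υs , eq′) σ with even⊎odd xs listed σ
        ... | inj₁ even = 𝔄⊆generated even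
        ... | inj₂ (τs , ts , 2∣τs , eq) = resp (λ x → cong (to σ) (strictlyInverseˡ τ x))
          (mul (𝔄⊆generated {σ ∙ τ} στ-even) (inv (gen s)))
          where
          στ-even : 𝔄 (σ ∙ τ)
          στ-even = τs ++ υs , ++⁺ ts us ,
            subst (2 ∣_) (sym (length-++ τs))
              (2∣2+n⇒2∣n (subst (2 ∣_) (cong suc (+-suc _ _)) (∣m∣n⇒∣m+n 2∣τs 2∣υs))) ,
            λ x → trans (cong (to σ) (eq′ x)) (trans (eq _) (sym (product-++ τs x)))

        symmetric⊎alternating : (∀ {σ} → S σ → 𝔄 σ) ⊎ ∃[ τ ] S τ × Odd τ →
          ⟨ 𝔖 A ⟩ S ≐ U ⊎ ⟨ 𝔖 A ⟩ S ≐ 𝔄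
        symmetric⊎alternating (inj₁ even) = inj₂ (generated⊆𝔄 even , 𝔄⊆generated)
        symmetric⊎alternating (inj₂ (τ , s , odd)) = inj₁ (_ , λ {σ} _ → odd-generates s odd σ)

-- Toggles of vertex covers

lookup-⇔ : ∀ {p q : Subset n} {i} → (i ∈ p → i ∈ q) → (i ∈ q → i ∈ p) → lookup p i ≡ lookup q i
lookup-⇔ {p = p} {q} {i} p⇒q q⇒p = iff
  (λ pi → []=⇒lookup (p⇒q (lookup⇒[]= i p pi)))
  (λ qi → []=⇒lookup (q⇒p (lookup⇒[]= i q qi)))
  where
  iff : ∀ {b c} → (b ≡ true → c ≡ true) → (c ≡ true → b ≡ true) → b ≡ c
  iff {true}          b⇒c _   = sym (b⇒c refl)
  iff {false} {true}  _   c⇒b = c⇒b refl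
  iff {false} {false} _   _   = refl

∉⇒lookup : ∀ {p : Subset n} {i} → i ∉ p → lookup p i ≡ false
∉⇒lookup {p = p} {i} i∉p = Bool.¬-not (i∉p ∘ lookup⇒[]= i p)

true≢false : ∀ {b} → b ≡ true → b ≢ false
true≢false refl ()

⟨⟩-mono : ∀ {𝒢 : Group 0ℓ 0ℓ} {S S′ : Pred (Group.Carrier 𝒢) 0ℓ} → S ⋐ S′ → ⟨ 𝒢 ⟩ S ⋐ ⟨ 𝒢 ⟩ S′
⟨⟩-mono S⊆S′ (gen s)    = gen (S⊆S′ s)
⟨⟩-mono S⊆S′ unit       = unit
⟨⟩-mono S⊆S′ (mul p q)  = mul (⟨⟩-mono S⊆S′ p) (⟨⟩-mono S⊆S′ q)
⟨⟩-mono S⊆S′ (inv p)    = inv (⟨⟩-mono S⊆S′ p)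
⟨⟩-mono S⊆S′ (resp e p) = resp e (⟨⟩-mono S⊆S′ p)

subsets : ∀ n → List (Subset n)
subsets zero    = [] ∷ []
subsets (suc n) = cartesianProductWith _∷_ (inside ∷ outside ∷ []) (subsets n)

∈-subsets : (X : Subset n) → X ∈ˡ subsets n
∈-subsets []      = here refl
∈-subsets (b ∷ X) = ∈-cartesianProductWith⁺ _∷_ (side b) (∈-subsets X)
  where
  side : ∀ b → b ∈ˡ (inside ∷ outside ∷ [])
  side true  = here refl
  side false = there (here refl)

module _ {P : Pred (Subset n) 0ℓ} where

  -- The indicator function. It determines the element, so equations between covers are checked one
  -- vertex at a time.
  χ : Refinement (Subset n) P → Fin n → Bool
  χ x = lookup (value x)

  χ-injective : ∀ {x y} → (∀ f → χ x f ≡ χ y f) → x ≡ y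
  χ-injective eq = value-injective (Pointwise-≡⇒≡ (ext eq))

module _ {E : Subset n} (𝓛 : Family E) where
  open Family 𝓛

  χ-outside : ∀ (x : Element) {f} → f ∉ E → χ x f ≡ false
  χ-outside (X ▸ [ p ]) f∉E = ∉⇒lookup (f∉E ∘ within (recompute (member? X) p))

  toggle-off : ∀ {e f} → f ≢ e → (x : Element) → χ (toggle 𝓛 e x) f ≡ χ x f
  toggle-off {e} f≢e (X ▸ p) with e ∈? X
  ... | no _ with member? (X ∪ ⁅ e ⁆)
  ...   | yes _ = lookup-⇔
            (λ f∈ → [ id , (λ f∈e → contradiction (x∈⁅y⁆⇒x≡y e f∈e) f≢e) ]′ (x∈p∪q⁻ X _ f∈))
            (x∈p∪q⁺ ∘ inj₁)
  ...   | no _  = refl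
  toggle-off {e} f≢e (X ▸ p) | yes _ with member? (X - e)
  ...   | yes _ = lookup-⇔ (p─q⊆p X _) (λ f∈X → x∈p∧x≢y⇒x∈p-y f∈X f≢e)
  ...   | no _  = refl

  element-≟ : DecidableEquality Element
  element-≟ = Refinement._≟_ (≡-dec Bool._≟_)

  -- The default `x₀` replaces subsets that are not members, so that mapping over all subsets lists
  -- every element, possibly repeating `x₀`.
  fromSubset : Element → Subset n → Element
  fromSubset x₀ X with member? X
  ... | yes p = X ▸ [ p ]
  ... | no _  = x₀

  fromSubset-value : ∀ x₀ x → fromSubset x₀ (value x) ≡ x
  fromSubset-value x₀ (X ▸ [ p ]) with member? X
  ... | yes _ = refl
  ... | no ¬p = contradiction (recompute (member? X) p) ¬p

  elements : Element → List Element
  elements x₀ = map (fromSubset x₀) (subsets n)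

  ∈-elements : ∀ x₀ x → x ∈ˡ elements x₀
  ∈-elements x₀ x = subst (_∈ˡ elements x₀) (fromSubset-value x₀ x)
    (∈-map⁺ (fromSubset x₀) (∈-subsets (value x)))

module VertexCovers (G : Graph n) where
  open Graph G using (V; _~_; _~?_; ~-sym; ~-irrefl; ~⇒∈V; IsVertexCover; isVertexCover?)
  open Family (𝒱𝒞 G) using (Element)

  ~⇒≢ : ∀ {u v} → u ~ v → u ≢ v
  ~⇒≢ u~v refl = ~-irrefl u~v

  -- For a vertex `e` this is exactly the condition under which toggling `e` changes the cover: a
  -- missing neighbour leaves an edge that only `e` covers.
  Free : Element → Fin n → Set
  Free x e = ∀ f → f ~ e → χ x f ≡ true

  free? : ∀ x e → Dec (Free x e)
  free? x e = Fin.all? λ f → (f ~? e) →-dec (χ x f Bool.≟ true)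

  uncovered⇒free : ∀ x {e} → χ x e ≡ false → Free x e
  uncovered⇒free (X ▸ [ p ]) {e} x≡false f f~e =
    [ []=⇒lookup , (λ e∈X → contradiction x≡false (true≢false ([]=⇒lookup e∈X))) ]′
      (proj₂ (recompute (isVertexCover? X) p) f e f~e)

  toggle-free : ∀ {e} → e ∈ V → (x : Element) → Free x e →
                χ (toggle (𝒱𝒞 G) e x) e ≡ not (χ x e)
  toggle-free {e} e∈V (X ▸ [ p ]) free = case e ∈? X of λ where
      (no e∉X) → trans
        (cong (λ x → χ x e) (toggle-add (𝒱𝒞 G) p e∉X (added (recompute (isVertexCover? X) p))))
        (trans ([]=⇒lookup (x∈p∪q⁺ {p = X} (inj₂ (x∈⁅x⁆ e)))) (cong not (sym (∉⇒lookup e∉X))))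
      (yes e∈X) → trans
        (cong (λ x → χ x e) (toggle-remove (𝒱𝒞 G) p e∈X (removed (recompute (isVertexCover? X) p))))
        (trans (∉⇒lookup (x∉p-x X e)) (cong not (sym ([]=⇒lookup e∈X))))
    where
    added : IsVertexCover X → IsVertexCover (X ∪ ⁅ e ⁆)
    added (X⊆V , cover) =
      (λ f∈ → [ X⊆V , (λ f∈e → subst (_∈ V) (sym (x∈⁅y⁆⇒x≡y e f∈e)) e∈V) ]′ (x∈p∪q⁻ X _ f∈)) ,
      λ u v u~v → [ inj₁ ∘ x∈p∪q⁺ ∘ inj₁ , inj₂ ∘ x∈p∪q⁺ ∘ inj₁ ]′ (cover u v u~v)
    removed : IsVertexCover X → IsVertexCover (X - e)
    removed (X⊆V , cover) = X⊆V ∘ p─q⊆p X _ , covered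
      where
      covered : ∀ u v → u ~ v → u ∈ X - e ⊎ v ∈ X - e
      covered u v u~v with u Fin.≟ e | v Fin.≟ e
      ... | yes refl | _ = inj₂ (x∈p∧x≢y⇒x∈p-y
              (lookup⇒[]= v X (free v (~-sym u~v))) (≢-sym (~⇒≢ u~v)))
      ... | no u≢e | yes refl = inj₁ (x∈p∧x≢y⇒x∈p-y (lookup⇒[]= u X (free u u~v)) u≢e)
      ... | no u≢e | no v≢e = [ (λ u∈X → inj₁ (x∈p∧x≢y⇒x∈p-y u∈X u≢e))
                              , (λ v∈X → inj₂ (x∈p∧x≢y⇒x∈p-y v∈X v≢e)) ]′ (cover u v u~v)

  -- If `e` were absent, all its neighbours would be present; so `e` is in the cover, and removing
  -- it would uncover an edge to a missing neighbour.
  toggle-stuck : ∀ {e} (x : Element) → ¬ Free x e → toggle (𝒱𝒞 G) e x ≡ x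
  toggle-stuck {e} x@(X ▸ [ p ]) ¬free = toggle-remove-fix (𝒱𝒞 G) p
    (lookup⇒[]= e X (Bool.¬-not (¬free ∘ uncovered⇒free x)))
    λ (_ , cover) → ¬free λ f f~e →
      [ []=⇒lookup ∘ p─q⊆p X _ , (λ e∈ → contradiction e∈ (x∉p-x X e)) ]′ (cover f e f~e)

  toggle-blocked : ∀ {e f} (x : Element) → f ~ e → χ x f ≡ false → toggle (𝒱𝒞 G) e x ≡ x
  toggle-blocked x f~e x≡false =
    toggle-stuck x (λ free → true≢false (free _ f~e) x≡false)

  full : Element
  full = V ▸ [ id , (λ u v u~v → inj₁ (~⇒∈V u~v)) ]

  full-free : ∀ {e} → Free full e
  full-free f f~e = []=⇒lookup (~⇒∈V f~e)

-- Connected graphs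

module Connectedness (G : Graph n) where
  open Graph G using (V; _~_; _~?_; ~-sym; ~⇒∈V)
  open Family (𝒱𝒞 G) using (Element)
  open VertexCovers G
  open Group (𝔖 Element) using (_∙_)

  infix 4 _≟ᵉ_
  _≟ᵉ_ : DecidableEquality Element
  _≟ᵉ_ = element-≟ (𝒱𝒞 G)

  TogglesIn : Subset n → Pred (Element ↔ Element) 0ℓ
  TogglesIn S σ = ∃[ e ] e ∈ S × σ ≡ t (𝒱𝒞 G) e

  ⟨t_⟩ : Subset n → Pred (Element ↔ Element) 0ℓ
  ⟨t S ⟩ = ⟨ 𝔖 Element ⟩ (TogglesIn S)

  -- X ↦ X ∩ S identifies these covers with the vertex covers of G ⟦ S ⟧.
  FullOff : Subset n → Pred Element 0ℓ
  FullOff S x = ∀ {f} → f ∈ V → f ∉ S → χ x f ≡ true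

  ⟨t⟩-off : ∀ {S g f} → f ∉ S → ⟨t S ⟩ g → ∀ x → χ (to g x) f ≡ χ x f
  ⟨t⟩-off f∉S (gen (e , e∈S , refl)) x =
    toggle-off (𝒱𝒞 G) (λ f≡e → f∉S (subst (_∈ _) (sym f≡e) e∈S)) x
  ⟨t⟩-off f∉S unit x = refl
  ⟨t⟩-off f∉S (mul p q) x = trans (⟨t⟩-off f∉S p _) (⟨t⟩-off f∉S q x)
  ⟨t⟩-off {f = f} f∉S (inv {g} p) x =
    trans (sym (⟨t⟩-off f∉S p (from g x))) (cong (λ y → χ y f) (strictlyInverseˡ g x))
  ⟨t⟩-off {f = f} f∉S (resp g≈h p) x =
    trans (cong (λ y → χ y f) (sym (g≈h x))) (⟨t⟩-off f∉S p x)

  FullOff-closed : ∀ {S g} → ⟨t S ⟩ g → ∀ {x} → FullOff S x → FullOff S (to g x)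
  FullOff-closed p {x} x-full f∈V f∉S = trans (⟨t⟩-off f∉S p x) (x-full f∈V f∉S)

  module On (S : Subset n) = ThreeCycles _≟ᵉ_ (TogglesIn S) (FullOff S) FullOff-closed

  full-off : ∀ {S} → FullOff S full
  full-off f∈V _ = []=⇒lookup f∈V

  full-unique : ∀ x → (∀ {f} → f ∈ V → χ x f ≡ true) → x ≡ full
  full-unique x x-full = χ-injective eq
    where
    eq : ∀ f → χ x f ≡ χ full f
    eq f with f ∈? V
    ... | yes f∈V = trans (x-full f∈V) (sym ([]=⇒lookup f∈V))
    ... | no  f∉V = trans (χ-outside (𝒱𝒞 G) x f∉V) (sym (∉⇒lookup f∉V))

  -- For `v ∈ V` this is `V` with `v` removed. Written as a toggle of `full`, it is moved back to
  -- `full` by `toggle-involutive`.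
  without : Fin n → Element
  without v = toggle (𝒱𝒞 G) v full

  without-self : ∀ {v} → v ∈ V → χ (without v) v ≡ false
  without-self v∈V = trans (toggle-free v∈V full full-free) (cong not ([]=⇒lookup v∈V))

  without-other : ∀ {u v} → u ∈ V → u ≢ v → χ (without v) u ≡ true
  without-other u∈V u≢v = trans (toggle-off (𝒱𝒞 G) u≢v full) ([]=⇒lookup u∈V)

  without-fixed : ∀ {u v} → u ~ v → toggle (𝒱𝒞 G) u (without v) ≡ without v
  without-fixed {v = v} u~v = toggle-blocked (without v) (~-sym u~v) (without-self (~⇒∈V (~-sym u~v)))

  toggle-move : ∀ e {x y} → toggle (𝒱𝒞 G) e x ≡ y → x ≡ toggle (𝒱𝒞 G) e y
  toggle-move e p = trans (sym (toggle-involutive (𝒱𝒞 G) e _)) (cong (toggle (𝒱𝒞 G) e) p)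

  full≢without : ∀ {v} → v ∈ V → full ≢ without v
  full≢without {v} v∈V eq =
    true≢false ([]=⇒lookup v∈V) (trans (cong (λ x → χ x v) eq) (without-self v∈V))

  -- Connected vertex sets with at least one edge, presented by the order in which their vertices
  -- are attached; the induction producing 3-cycles follows this order. The premise `v ∉ S` ensures
  -- that toggles at vertices of `S` never change `v`.
  data Grown : Subset n → Set where
    edge   : ∀ {u w} → u ~ w → Grown (⁅ u ⁆ ∪ ⁅ w ⁆)
    extend : ∀ {S w v} → Grown S → w ∈ S → v ∉ S → v ~ w → Grown (S ∪ ⁅ v ⁆)

  ∈-pair : ∀ (Q : Pred (Fin n) 0ℓ) {u w} → Q u → Q w → ∀ {x} → x ∈ ⁅ u ⁆ ∪ ⁅ w ⁆ → Q x
  ∈-pair Q {u} {w} qu qw x∈ =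
    [ (λ p → subst Q (sym (x∈⁅y⁆⇒x≡y u p)) qu) , (λ p → subst Q (sym (x∈⁅y⁆⇒x≡y w p)) qw) ]′
      (x∈p∪q⁻ _ _ x∈)

  ∈-extend : ∀ (Q : Pred (Fin n) 0ℓ) {S v} → (∀ {x} → x ∈ S → Q x) → Q v →
    ∀ {x} → x ∈ S ∪ ⁅ v ⁆ → Q x
  ∈-extend Q {v = v} qS qv x∈ = [ qS , (λ p → subst Q (sym (x∈⁅y⁆⇒x≡y v p)) qv) ]′ (x∈p∪q⁻ _ _ x∈)

  left∈ : ∀ {S v} {x : Fin n} → x ∈ S → x ∈ S ∪ ⁅ v ⁆
  left∈ = x∈p∪q⁺ ∘ inj₁

  new∈ : ∀ {S : Subset n} {v} → v ∈ S ∪ ⁅ v ⁆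
  new∈ = x∈p∪q⁺ (inj₂ (x∈⁅x⁆ _))

  grown⊆V : ∀ {S} → Grown S → S ⊆ V
  grown⊆V (edge u~w)           = ∈-pair (_∈ V) (~⇒∈V u~w) (~⇒∈V (~-sym u~w))
  grown⊆V (extend gr _ _ v~w)  = ∈-extend (_∈ V) (grown⊆V gr) (~⇒∈V v~w)

  -- Supplies the edge inside `S` at the attaching vertex, from which the commutator step starts.
  neighbour : ∀ {S} → Grown S → ∀ {x} → x ∈ S → ∃[ y ] y ∈ S × x ~ y
  neighbour (edge {u} {w} u~w) = ∈-pair (λ x → ∃[ y ] y ∈ ⁅ u ⁆ ∪ ⁅ w ⁆ × x ~ y)
    (w , new∈ , u~w) (u , left∈ (x∈⁅x⁆ u) , ~-sym u~w)
  neighbour (extend {S} {v = v} gr w∈S _ v~w) = ∈-extend (λ x → ∃[ y ] y ∈ S ∪ ⁅ v ⁆ × x ~ y)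
    (λ x∈S → case neighbour gr x∈S of λ (y , y∈S , x~y) → y , left∈ y∈S , x~y)
    (_ , left∈ w∈S , v~w)

  -- Connectedness as an induction principle. After an extension every passage between the new
  -- vertex and the old ones goes through the attaching vertex `w`.
  propagate : ∀ {S} {Q : Pred (Fin n) 0ℓ} → Grown S →
    (∀ {x y} → x ∈ S → y ∈ S → x ~ y → Q x → Q y) →
    ∀ {x} → x ∈ S → Q x → ∀ {y} → y ∈ S → Q y
  propagate {Q = Q} (edge {u} {w} u~w) step =
    ∈-pair (λ x → Q x → ∀ {y} → y ∈ ⁅ u ⁆ ∪ ⁅ w ⁆ → Q y)
      (λ qu → ∈-pair Q qu (step u∈ new∈ u~w qu))
      (λ qw → ∈-pair Q (step new∈ u∈ (~-sym u~w) qw) qw)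
    where
    u∈ = left∈ (x∈⁅x⁆ u)
  propagate {Q = Q} (extend {S} {w} {v} gr w∈S _ v~w) step x∈ qx = from-w (to-w x∈ qx)
    where
    inner : ∀ {x} → x ∈ S → Q x → ∀ {y} → y ∈ S → Q y
    inner = propagate gr (λ x∈S y∈S → step (left∈ x∈S) (left∈ y∈S))
    to-w : ∀ {x} → x ∈ S ∪ ⁅ v ⁆ → Q x → Q w
    to-w = ∈-extend (λ x → Q x → Q w)
      (λ x∈S qx → inner x∈S qx w∈S) (step new∈ (left∈ w∈S) v~w)
    from-w : Q w → ∀ {y} → y ∈ S ∪ ⁅ v ⁆ → Q y
    from-w qw = ∈-extend Q (inner w∈S qw) (step (left∈ w∈S) new∈ (~-sym v~w) qw)

  -- From one 3-cycle to all 3-cycles on a grown set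

  module _ {S : Subset n} (gr : Grown S) where
    open On S

    private
      toggle∈ : ∀ {e} → e ∈ S → ⟨t S ⟩ (t (𝒱𝒞 G) e)
      toggle∈ e∈S = gen (_ , e∈S , refl)

    without≈full : ∀ {w} → w ∈ S → full ≈ without w → ∀ {x} → x ∈ S → full ≈ without x
    without≈full = propagate gr λ {x} {y} x∈S y∈S x~y full≈x →
      ≈-trans full-off full≈x (≈-sym
        (subst (without y ≈_) (without-fixed (~-sym x~y)) (≈-cong (toggle∈ y∈S) full≈x)))

    -- Induction on a list `fs` containing every vertex missing from `x`. A missing `h` lies in `S`,
    -- and toggling it puts it back; applying that toggle to the induction hypothesis gives
    -- `without h ≈ x`, while `full ≈ without h` by `without≈full`.
    all≈full : ∀ {w} → w ∈ S → full ≈ without w →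
      ∀ fs {x} → FullOff S x → (∀ {f} → f ∈ V → χ x f ≡ false → f ∈ˡ fs) → full ≈ x
    all≈full w∈S full≈w [] {x} x-full missing = inj₁ (sym (full-unique x λ {f} f∈V →
      Bool.¬-not λ x≡false → case missing f∈V x≡false of λ ()))
    all≈full w∈S full≈w (h ∷ fs) {x} x-full missing with χ x h in x-h | h ∈? V
    ... | true | _ = all≈full w∈S full≈w fs x-full λ f∈V x≡false → case missing f∈V x≡false of λ where
          (here refl)   → contradiction x≡false (true≢false x-h)
          (there f∈fs)  → f∈fs
    ... | false | no h∉V = all≈full w∈S full≈w fs x-full λ f∈V x≡false → case missing f∈V x≡false of λ where
          (here refl)   → contradiction f∈V h∉V
          (there f∈fs)  → f∈fs
    ... | false | yes h∈V = ≈-trans full-off (without≈full w∈S full≈w h∈S)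
          (subst (without h ≈_) (toggle-involutive (𝒱𝒞 G) h x)
            (≈-cong (toggle∈ h∈S)
              (all≈full w∈S full≈w fs (FullOff-closed (toggle∈ h∈S) x-full) missing′)))
      where
      h∈S : h ∈ S
      h∈S with h ∈? S
      ... | yes h∈S = h∈S
      ... | no  h∉S = contradiction x-h (true≢false (x-full h∈V h∉S))
      missing′ : ∀ {f} → f ∈ V → χ (toggle (𝒱𝒞 G) h x) f ≡ false → f ∈ˡ fs
      missing′ {f} f∈V ≡false with f Fin.≟ h
      ... | yes refl = contradiction ≡false (true≢false
              (trans (toggle-free h∈V x (uncovered⇒free x x-h)) (cong not x-h)))
      ... | no f≢h with missing f∈V (trans (sym (toggle-off (𝒱𝒞 G) f≢h x)) ≡false)
      ...   | here f≡h   = contradiction f≡h f≢h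
      ...   | there f∈fs = f∈fs

    cycle⇒all-cycles : ∀ {w c} → w ∈ S → Cycle full (without w) c →
      ∀ {a b c} → FullOff S a → FullOff S b → FullOff S c → a ≢ b → b ≢ c → c ≢ a → Cycle a b c
    cycle⇒all-cycles w∈S z = all-cycles λ x-full y-full →
      ≈-trans x-full (≈-sym (≈full x-full)) (≈full y-full)
      where
      ≈full : ∀ {x} → FullOff S x → full ≈ x
      ≈full x-full = all≈full w∈S (inj₂ (_ , z)) (allFin n) x-full λ {f} _ _ → ∈-allFin f

  -- For a single edge the only covers full elsewhere are `full`, `without w` and `without u`, and
  -- the toggle of `w` followed by that of `u` rotates them. For an extension, `commutator` is
  -- applied to the toggle of `w` and a 3-cycle of the smaller set.
  grown-cycles : ∀ {S} → Grown S → ∀ {a b c} → FullOff S a → FullOff S b → FullOff S c →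
    a ≢ b → b ≢ c → c ≢ a → On.Cycle S a b c
  grown-cycles gr@(edge {u} {w} u~w) = cycle⇒all-cycles gr w∈
    ( t (𝒱𝒞 G) u ∙ t (𝒱𝒞 G) w
    , mul (gen (u , u∈ , refl)) (gen (w , w∈ , refl))
    , record
      { a↦b = without-fixed u~w
      ; b↦c = cong (toggle (𝒱𝒞 G) u) (toggle-involutive (𝒱𝒞 G) w full)
      ; c↦a = trans (cong (toggle (𝒱𝒞 G) u) (without-fixed (~-sym u~w)))
                    (toggle-involutive (𝒱𝒞 G) u full)
      ; fixes = λ x-full x≢full x≢w x≢u → contradiction (exhausted x-full x≢w x≢u) x≢full
      })
    where
    S = ⁅ u ⁆ ∪ ⁅ w ⁆
    u∈ : u ∈ S
    u∈ = left∈ (x∈⁅x⁆ u)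
    w∈ : w ∈ S
    w∈ = new∈
    S-full : ∀ x → FullOff S x → χ x u ≡ true → χ x w ≡ true → x ≡ full
    S-full x x-full xu xw = full-unique x λ {f} f∈V → case f ∈? S of λ where
      (yes f∈S) → ∈-pair (λ f → χ x f ≡ true) xu xw f∈S
      (no  f∉S) → x-full f∈V f∉S
    -- As `e` is missing, `f` is present, so toggling `e` turns `x` into `full`.
    single : ∀ {e f x} → e ∈ S → f ~ e → FullOff S x → χ x e ≡ false →
      (∀ y → FullOff S y → χ y e ≡ true → χ y f ≡ true → y ≡ full) → x ≡ without e
    single {e} {f} {x} e∈S f~e x-full xe e,f-full = toggle-move e (e,f-full (toggle (𝒱𝒞 G) e x)
      (FullOff-closed (gen (e , e∈S , refl)) x-full)
      (trans (toggle-free (~⇒∈V (~-sym f~e)) x (uncovered⇒free x xe)) (cong not xe))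
      (trans (toggle-off (𝒱𝒞 G) (~⇒≢ f~e) x) (uncovered⇒free x xe f f~e)))
    exhausted : ∀ {x} → FullOff S x → x ≢ without w → x ≢ without u → x ≡ full
    exhausted {x} x-full x≢w x≢u = S-full x x-full
      (Bool.¬-not λ xu → x≢u (single u∈ (~-sym u~w) x-full xu S-full))
      (Bool.¬-not λ xw → x≢w (single w∈ u~w x-full xw λ y y-full yw yu → S-full y y-full yu yw))
  grown-cycles gr@(extend {S} {w} {v} gr′ w∈S v∉S v~w) with neighbour gr′ w∈S
  ... | u , u∈S , w~u = cycle⇒all-cycles gr (left∈ w∈S) extended
    where
    S′ = S ∪ ⁅ v ⁆
    w∈V = grown⊆V gr′ w∈S
    u∈V = grown⊆V gr′ u∈S
    without-off : ∀ {e} → e ∈ S → FullOff S (without e)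
    without-off e∈S = FullOff-closed (gen (_ , e∈S , refl)) full-off
    w≢u : without w ≢ without u
    w≢u eq = true≢false (without-other w∈V (~⇒≢ w~u))
      (trans (cong (λ x → χ x w) (sym eq)) (without-self w∈V))
    inner : On.Cycle S full (without w) (without u)
    inner = grown-cycles gr′ full-off (without-off w∈S) (without-off u∈S)
      (full≢without w∈V) w≢u (≢-sym (full≢without u∈V))
    extended : On.Cycle S′ full (without w) (without u)
    extended with inner
    ... | g , g∈ , r = On.commutator S′ (gen (w , left∈ w∈S , refl)) refl
      (toggle-involutive (𝒱𝒞 G) w full) (without-fixed w~u)
      (⟨⟩-mono (λ (e , e∈S , σ≡) → e , left∈ e∈S , σ≡) g∈) (a↦b r) (b↦c r) (c↦a r) elsewhere
      where
      elsewhere : ∀ {x} → FullOff S′ x → x ≢ full → x ≢ without w → x ≢ without u →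
        (to g x ≡ x × to g (toggle (𝒱𝒞 G) w x) ≡ toggle (𝒱𝒞 G) w x) ⊎
        (toggle (𝒱𝒞 G) w x ≡ x × toggle (𝒱𝒞 G) w (from g x) ≡ from g x)
      -- If `v` is missing from `x`, it is also missing from `from g x`, and the toggle of `w` is
      -- blocked at both. Otherwise `x` is full off `S`, where `g` moves only the three named
      -- covers; the toggle of `w` permutes these three, so it cannot send `x` to one of them.
      elsewhere {x} x-full x≢full x≢w x≢u with χ x v in xv
      ... | false = inj₂
            ( toggle-blocked x v~w xv
            , toggle-blocked (from g x) v~w (trans (⟨t⟩-off v∉S (inv g∈) x) xv) )
      ... | true  = inj₁
            ( fixes r x-off x≢full x≢w x≢u
            , fixes r (FullOff-closed (gen (w , w∈S , refl)) x-off)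
                (λ eq → x≢w (toggle-move w eq))
                (λ eq → x≢full (trans (toggle-move w eq) (toggle-involutive (𝒱𝒞 G) w full)))
                (λ eq → x≢u (trans (toggle-move w eq) (without-fixed w~u))) )
        where
        x-off : FullOff S x
        x-off {f} f∈V f∉S with f Fin.≟ v
        ... | yes refl = xv
        ... | no f≢v   = x-full f∈V λ f∈ →
              [ f∉S , (λ f∈v → f≢v (x∈⁅y⁆⇒x≡y v f∈v)) ]′ (x∈p∪q⁻ S _ f∈)

  -- Each vertex of the walk that is not yet in the set is attached to its predecessor, which is.
  reach : ∀ {S s x} → Grown S → s ∈ S → Star _~_ s x → ∃[ S′ ] Grown S′ × S ⊆ S′ × x ∈ S′
  reach gr s∈S Star.ε = _ , gr , id , s∈S
  reach {S} gr s∈S (_◅_ {j = y} s~y walk) with y ∈? S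
  ... | yes y∈S = reach gr y∈S walk
  ... | no  y∉S with reach (extend gr s∈S y∉S (~-sym s~y)) new∈ walk
  ...   | S′ , gr′ , S⊆S′ , x∈S′ = S′ , gr′ , S⊆S′ ∘ left∈ , x∈S′

  grow : Connected G → ∀ {S s} → Grown S → s ∈ S → ∀ fs →
    ∃[ S′ ] Grown S′ × S ⊆ S′ × (∀ {f} → f ∈ V → f ∈ˡ fs → f ∈ S′)
  grow connected gr s∈S [] = _ , gr , id , λ _ ()
  grow connected gr s∈S (h ∷ fs) with grow connected gr s∈S fs | h ∈? V
  ... | S₁ , gr₁ , S⊆S₁ , fs⊆S₁ | no h∉V = S₁ , gr₁ , S⊆S₁ , λ where
        f∈V (here refl)  → contradiction f∈V h∉V
        f∈V (there f∈fs) → fs⊆S₁ f∈V f∈fs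
  ... | S₁ , gr₁ , S⊆S₁ , fs⊆S₁ | yes h∈V
    with reach gr₁ (S⊆S₁ s∈S) (connected (grown⊆V gr s∈S) h∈V)
  ...   | S₂ , gr₂ , S₁⊆S₂ , h∈S₂ = S₂ , gr₂ , S₁⊆S₂ ∘ S⊆S₁ , λ where
        _   (here refl)  → h∈S₂
        f∈V (there f∈fs) → S₁⊆S₂ (fs⊆S₁ f∈V f∈fs)

  -- Connected graphs: all 3-cycles and the parity of the toggles

  module Whole = ThreeCycles _≟ᵉ_ (IsToggle (𝒱𝒞 G)) (λ _ → ⊤) (λ _ _ → tt)

  connected-cycles : Connected G → ∀ {a b c} → a ≢ b → b ≢ c → c ≢ a → Whole.Cycle a b c
  connected-cycles connected {a} {b} {c} a≢b b≢c c≢a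
    with Fin.any? (λ u → Fin.any? (λ w → u ~? w))
  ... | yes (u , w , u~w) with grow connected (edge u~w) new∈ (allFin n)
  ...   | S , gr , _ , V⊆S = whole (grown-cycles gr (off a) (off b) (off c) a≢b b≢c c≢a)
    where
    -- `S` contains all of `V`, so the condition is vacuous and the cycle is one on all covers.
    off : ∀ x → FullOff S x
    off x f∈V f∉S = contradiction (V⊆S f∈V (∈-allFin _)) f∉S
    whole : On.Cycle S a b c → Whole.Cycle a b c
    whole (g , g∈ , r) = g , ⟨⟩-mono (λ (e , e∈S , σ≡) → e , grown⊆V gr e∈S , σ≡) g∈ , record
      { a↦b = a↦b r ; b↦c = b↦c r ; c↦a = c↦a r ; fixes = λ {x} _ → fixes r (off x) }
  -- A connected graph without edges has at most one vertex, hence at most two covers, so no three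
  -- are distinct.
  connected-cycles connected {a} {b} {c} a≢b b≢c c≢a | no no-edge = two-of-three
    where
    single : ∀ {u v} → u ∈ V → v ∈ V → u ≡ v
    single u∈V v∈V with connected u∈V v∈V
    ... | Star.ε  = refl
    ... | u~w ◅ _ = contradiction (_ , _ , u~w) no-edge
    empty : ∀ {x} → x ≢ full → ∀ f → χ x f ≡ false
    empty {x} x≢full f with f ∈? V
    ... | no f∉V  = χ-outside (𝒱𝒞 G) x f∉V
    ... | yes f∈V = Bool.¬-not λ xf → x≢full (full-unique x λ {h} h∈V →
            trans (cong (lookup (value x)) (single h∈V f∈V)) xf)
    nonfull-≡ : ∀ {x y} → x ≢ full → y ≢ full → x ≡ y
    nonfull-≡ x≢full y≢full = χ-injective λ f → trans (empty x≢full f) (sym (empty y≢full f))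
    two-of-three : Whole.Cycle a b c
    two-of-three with a ≟ᵉ full | b ≟ᵉ full
    ... | yes refl | _ = contradiction (nonfull-≡ (≢-sym a≢b) c≢a) b≢c
    ... | no a≢full | yes refl = contradiction (nonfull-≡ (≢-sym b≢c) a≢full) c≢a
    ... | no a≢full | no b≢full = contradiction (nonfull-≡ a≢full b≢full) a≢b

  connected⇒symmetric⊎alternating :
    Connected G → InT (𝒱𝒞 G) ≐ U ⊎ InT (𝒱𝒞 G) ≐ 𝔄
  connected⇒symmetric⊎alternating connected =
    symmetric⊎alternating _≟ᵉ_ (IsToggle (𝒱𝒞 G)) (connected-cycles connected)
      (elements (𝒱𝒞 G) full) (∈-elements (𝒱𝒞 G) full) parities
    where
    -- The first alternative is conditional on `e ∈ V`: labels outside `V` satisfy it vacuously, and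
    -- the search can run over all of `Fin n`.
    parity-of : ∀ e → (e ∈ V → 𝔄 (t (𝒱𝒞 G) e)) ⊎ (e ∈ V × Odd _≟ᵉ_ (t (𝒱𝒞 G) e))
    parity-of e with e ∈? V
    ... | no e∉V = inj₁ λ e∈V → contradiction e∈V e∉V
    ... | yes e∈V with even⊎odd _≟ᵉ_ (elements (𝒱𝒞 G) full) (∈-elements (𝒱𝒞 G) full) (t (𝒱𝒞 G) e)
    ...   | inj₁ even = inj₁ λ _ → even
    ...   | inj₂ odd  = inj₂ (e∈V , odd)
    parities : (∀ {σ} → IsToggle (𝒱𝒞 G) σ → 𝔄 σ) ⊎ ∃[ τ ] IsToggle (𝒱𝒞 G) τ × Odd _≟ᵉ_ τ
    parities with All.decide parity-of (allFin n)
    ... | inj₁ even = inj₁ λ { (e , e∈V , refl) → All.lookup even (∈-allFin e) e∈V }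
    ... | inj₂ odd with Any.satisfied odd
    ...   | e , e∈V , o = inj₂ (_ , (e , e∈V , refl) , o)

-- Homomorphisms into direct products

module _ where
  open Group using (Carrier; _≈_; _∙_; _⁻¹)

  -- Elements of `∏ ℋ` are nested pairs; `tuple` and `component` translate from and to families
  -- indexed by `Fin k`.
  tuple : {ℋ : Fin k → Group a ℓ} → (∀ i → Carrier (ℋ i)) → Carrier (∏ ℋ)
  tuple {zero}  h = _
  tuple {suc _} h = h zero , tuple (h ∘ suc)

  component : {ℋ : Fin k → Group a ℓ} → Carrier (∏ ℋ) → ∀ i → Carrier (ℋ i)
  component (h , _)  zero    = h
  component (_ , hs) (suc i) = component hs i

  tuple-≈ : {ℋ : Fin k → Group a ℓ} {h : ∀ i → Carrier (ℋ i)} {y : Carrier (∏ ℋ)} →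
    (∀ i → _≈_ (ℋ i) (h i) (component y i)) → _≈_ (∏ ℋ) (tuple h) y
  tuple-≈ {zero}  eq = _
  tuple-≈ {suc _} eq = eq zero , tuple-≈ (eq ∘ suc)

  component-tuple : {ℋ : Fin k → Group a ℓ} (h : ∀ i → Carrier (ℋ i)) → ∀ i →
    _≈_ (ℋ i) (component {ℋ = ℋ} (tuple h) i) (h i)
  component-tuple {ℋ = ℋ} h zero    = Group.refl (ℋ zero)
  component-tuple {ℋ = ℋ} h (suc i) = component-tuple {ℋ = ℋ ∘ suc} (h ∘ suc) i

  component-≈ : {ℋ : Fin k → Group a ℓ} {x y : Carrier (∏ ℋ)} →
    _≈_ (∏ ℋ) x y → ∀ i → _≈_ (ℋ i) (component x i) (component y i)
  component-≈ (p , _)  zero    = p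
  component-≈ (_ , ps) (suc i) = component-≈ ps i

  component-∙ : {ℋ : Fin k → Group a ℓ} (x y : Carrier (∏ ℋ)) → ∀ i →
    component (_∙_ (∏ ℋ) x y) i ≡ _∙_ (ℋ i) (component x i) (component y i)
  component-∙ x y zero = refl
  component-∙ (_ , x) (_ , y) (suc i) = component-∙ x y i

  component-ε : (ℋ : Fin k → Group a ℓ) → ∀ i → component {ℋ = ℋ} (Group.ε (∏ ℋ)) i ≡ Group.ε (ℋ i)
  component-ε ℋ zero    = refl
  component-ε ℋ (suc i) = component-ε (ℋ ∘ suc) i

  component-⁻¹ : {ℋ : Fin k → Group a ℓ} (x : Carrier (∏ ℋ)) → ∀ i →
    component (_⁻¹ (∏ ℋ) x) i ≡ _⁻¹ (ℋ i) (component x i)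
  component-⁻¹ x zero = refl
  component-⁻¹ (_ , x) (suc i) = component-⁻¹ x i

  module _ {𝒢 : Group a ℓ} where
    private
      module 𝒢 = Group 𝒢

    Homs : (ℋ : Fin k → Group a ℓ) → (∀ i → 𝒢.Carrier → Carrier (ℋ i)) → Set _
    Homs ℋ F = ∀ i → IsGroupHomomorphism 𝒢.rawGroup (Group.rawGroup (ℋ i)) (F i)

    Coordinates : (ℋ : Fin k → Group a ℓ) → (∀ i → 𝒢.Carrier → Carrier (ℋ i)) → Set _
    Coordinates ℋ F = ∀ i h → ∃[ g ] _≈_ (ℋ i) (F i g) h ×
      (∀ j → j ≢ i → _≈_ (ℋ j) (F j g) (Group.ε (ℋ j)))

    -- Induction on the number of factors. Once `g` has the right later coordinates, `g₀` corrects
    -- the first one from `F zero g` to `h zero` and, being trivial in the others, leaves them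
    -- intact.
    simultaneous : {ℋ : Fin k → Group a ℓ} {F : ∀ i → 𝒢.Carrier → Carrier (ℋ i)} →
      Homs ℋ F → Coordinates ℋ F →
      ∀ (h : ∀ i → Carrier (ℋ i)) → ∃[ g ] ∀ i → _≈_ (ℋ i) (F i g) (h i)
    simultaneous {k = zero} _ _ h = 𝒢.ε , λ ()
    simultaneous {k = suc _} {ℋ} {F} homs coords h
      with simultaneous {ℋ = ℋ ∘ suc} (homs ∘ suc)
             (λ i y → case coords (suc i) y of λ (g , g≈ , rest) →
               g , g≈ , λ j j≢i → rest (suc j) (j≢i ∘ Fin.suc-injective))
             (h ∘ suc)
    ... | g , g≈ with coords zero (Group._∙_ (ℋ zero) (h zero) (Group._⁻¹ (ℋ zero) (F zero g)))
    ...   | g₀ , g₀≈ , rest = g₀ 𝒢.∙ g , image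
      where
      open IsGroupHomomorphism
      module ℋ i = Group (ℋ i)
      image : ∀ i → _≈_ (ℋ i) (F i (g₀ 𝒢.∙ g)) (h i)
      image zero    = ℋ.trans zero (homo (homs zero) g₀ g)
        (ℋ.trans zero (ℋ.∙-congʳ zero g₀≈) (//-rightDividesˡ (ℋ zero) _ _))
      image (suc i) = ℋ.trans (suc i) (homo (homs (suc i)) g₀ g)
        (ℋ.trans (suc i) (ℋ.∙-cong (suc i) (rest (suc i) λ ()) (g≈ i)) (ℋ.identityˡ (suc i) _))

    -- Surjectivity comes from `Coordinates` through `simultaneous`, injectivity from `joint`.
    ∏-isomorphism : {ℋ : Fin k → Group a ℓ} (F : ∀ i → 𝒢.Carrier → Carrier (ℋ i)) →
      Homs ℋ F → Coordinates ℋ F →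
      (∀ {x y} → (∀ i → _≈_ (ℋ i) (F i x) (F i y)) → x 𝒢.≈ y) →
      𝒢 ≅ ∏ ℋ
    ∏-isomorphism {ℋ = ℋ} F homs coords joint = (λ g → tuple λ i → F i g) , record
      { isGroupMonomorphism = record
        { isGroupHomomorphism = record
          { isMonoidHomomorphism = record
            { isMagmaHomomorphism = record
              { isRelHomomorphism = record
                { cong = λ {x} {y} x≈y → tuple-≈ λ i → ℋ.trans i (⟦⟧-cong (homs i) x≈y) (F≈ y i) }
              ; homo = λ x y → tuple-≈ λ i → ℋ.trans i (homo (homs i) x y) (ℋ.trans i
                  (ℋ.∙-cong i (F≈ x i) (F≈ y i))
                  (ℋ.reflexive i (sym (component-∙ {ℋ = ℋ} _ _ i))))
              }
            ; ε-homo = tuple-≈ λ i → ℋ.trans i (ε-homo (homs i))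
                (ℋ.reflexive i (sym (component-ε ℋ i)))
            }
          ; ⁻¹-homo = λ x → tuple-≈ λ i → ℋ.trans i (⁻¹-homo (homs i) x) (ℋ.trans i
              (ℋ.⁻¹-cong i (F≈ x i))
              (ℋ.reflexive i (sym (component-⁻¹ {ℋ = ℋ} _ i))))
          }
        ; injective = λ {x} {y} fx≈fy → joint λ i → ℋ.trans i (F≈ x i)
            (ℋ.trans i (component-≈ {ℋ = ℋ} fx≈fy i) (ℋ.sym i (F≈ y i)))
        }
      ; surjective = λ y → let g , g≈ = simultaneous {ℋ = ℋ} homs coords (component y) in
          g , λ z≈g → tuple-≈ λ i → ℋ.trans i (⟦⟧-cong (homs i) z≈g) (g≈ i)
      }
      where
      open IsGroupHomomorphism
      module ℋ i = Group (ℋ i)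
      F≈ : ∀ g i → _≈_ (ℋ i) (F i g) (component {ℋ = ℋ} (tuple λ i → F i g) i)
      F≈ g i = ℋ.sym i (component-tuple {ℋ = ℋ} (λ i → F i g) i)

-- Homomorphisms induced by an equivariant surjection

module _ {A B : Set} (φ : A → B) where

  Intertwines : A ↔ A → B ↔ B → Set
  Intertwines g h = ∀ x → φ (to g x) ≡ to h (φ x)

  intertwines-inverse : ∀ {g h} → Intertwines g h → ∀ x → φ (from g x) ≡ from h (φ x)
  intertwines-inverse {g} {h} p x =
    sym (from-≡ h (trans (sym (p (from g x))) (cong φ (strictlyInverseˡ g x))))

  module _ (φ-surjective : ∀ y → ∃[ x ] φ x ≡ y) where

    intertwines-unique : ∀ {g h h′} → Intertwines g h → Intertwines g h′ → ∀ y → to h y ≡ to h′ y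
    intertwines-unique {h = h} {h′} p q y with φ-surjective y
    ... | x , refl = trans (sym (p x)) (q x)

    module Induced {S : Pred (A ↔ A) 0ℓ} {S′ : Pred (B ↔ B) 0ℓ}
      (on-generators : ∀ {g} → S g → ∃[ h ] ⟨ 𝔖 B ⟩ S′ h × Intertwines g h) where

      private
        module 𝒜 = Group (generatedSubgroup (𝔖 A) S)
        module ℬ = Group (generatedSubgroup (𝔖 B) S′)

      -- The image is read off a derivation of membership. Different derivations still give the same
      -- permutation: as `φ` is surjective, at most one permutation of `B` intertwines with `g`.
      image : ∀ {g} → ⟨ 𝔖 A ⟩ S g → ∃[ h ] ⟨ 𝔖 B ⟩ S′ h × Intertwines g h
      image (gen s) = on-generators s
      image unit = Group.ε (𝔖 B) , unit , λ _ → refl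
      image (mul {g} {g′} p q) with image p | image q
      ... | h , h∈ , r | h′ , h′∈ , r′ = Group._∙_ (𝔖 B) h h′ , mul h∈ h′∈ ,
        λ x → trans (r (to g′ x)) (cong (to h) (r′ x))
      image (inv {g} p) with image p
      ... | h , h∈ , r = Group._⁻¹ (𝔖 B) h , inv h∈ , intertwines-inverse {g} {h} r
      image (resp g≈g′ p) with image p
      ... | h , h∈ , r = h , h∈ , λ x → trans (cong φ (sym (g≈g′ x))) (r x)

      induced : 𝒜.Carrier → ℬ.Carrier
      induced (_ , p) = let h , h∈ , _ = image p in h , h∈

      induced-intertwines : ∀ g → Intertwines (proj₁ g) (proj₁ (induced g))
      induced-intertwines (_ , p) = proj₂ (proj₂ (image p))

      induced-unique : ∀ g h → Intertwines (proj₁ g) (proj₁ h) → induced g ℬ.≈ h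
      induced-unique g h = intertwines-unique {proj₁ g} {proj₁ (induced g)} {proj₁ h}
        (induced-intertwines g)

      induced-isGroupHomomorphism : IsGroupHomomorphism 𝒜.rawGroup ℬ.rawGroup induced
      induced-isGroupHomomorphism = record
        { isMonoidHomomorphism = record
          { isMagmaHomomorphism = record
            { isRelHomomorphism = record
              { cong = λ {g} {g′} g≈g′ → induced-unique g (induced g′)
                  λ x → trans (cong φ (g≈g′ x)) (induced-intertwines g′ x) }
            ; homo = λ _ _ _ → refl
            }
          ; ε-homo = λ _ → refl
          }
        ; ⁻¹-homo = λ _ _ → refl
        }

-- Restriction to components

module Restriction (G : Graph n) where
  open Graph G using (V; _~_; ~-sym; ~⇒∈V)
  open Family using (Element)

  restrict : ∀ S → Element (𝒱𝒞 G) → Element (𝒱𝒞 (G ⟦ S ⟧))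
  restrict S (X ▸ [ p ]) = (X ∩ S) ▸ [ restricted p ]
    where
    restricted : Graph.IsVertexCover G X → Graph.IsVertexCover (G ⟦ S ⟧) (X ∩ S)
    restricted (X⊆V , cover) =
      (λ f∈ → let f∈X , f∈S = x∈p∩q⁻ X S f∈ in x∈p∩q⁺ (X⊆V f∈X , f∈S)) ,
      λ u v (u~v , u∈S , v∈S) →
        [ (λ u∈X → inj₁ (x∈p∩q⁺ (u∈X , u∈S))) , (λ v∈X → inj₂ (x∈p∩q⁺ (v∈X , v∈S))) ]′ (cover u v u~v)

  χ-restrict : ∀ S x f → χ (restrict S x) f ≡ χ x f ∧ lookup S f
  χ-restrict S (X ▸ _) f = lookup-zipWith _∧_ f X S

  χ-restrict-∈ : ∀ {S} x {f} → f ∈ S → χ (restrict S x) f ≡ χ x f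
  χ-restrict-∈ {S} x {f} f∈S = trans (χ-restrict S x f)
    (trans (cong (χ x f ∧_) ([]=⇒lookup f∈S)) (Bool.∧-identityʳ _))

  χ-restrict-∉ : ∀ {S} x {f} → f ∉ S → χ (restrict S x) f ≡ false
  χ-restrict-∉ {S} x {f} f∉S = trans (χ-restrict S x f)
    (trans (cong (χ x f ∧_) (∉⇒lookup f∉S)) (Bool.∧-zeroʳ _))

  -- Adding all vertices outside `S` covers every edge with an end outside `S`; the remaining edges
  -- belong to `G ⟦ S ⟧`.
  restrict-surjective : ∀ S y → ∃[ x ] restrict S x ≡ y
  restrict-surjective S y@(Y ▸ [ p ]) = x , χ-injective eq
    where
    extended : Graph.IsVertexCover (G ⟦ S ⟧) Y → Graph.IsVertexCover G (Y ∪ (V ∩ ∁ S))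
    extended (Y⊆ , cover) =
      (λ f∈ → [ proj₁ ∘ x∈p∩q⁻ V S ∘ Y⊆ , proj₁ ∘ x∈p∩q⁻ V (∁ S) ]′ (x∈p∪q⁻ Y _ f∈)) , covered
      where
      covered : ∀ u v → u ~ v → u ∈ Y ∪ (V ∩ ∁ S) ⊎ v ∈ Y ∪ (V ∩ ∁ S)
      covered u v u~v with u ∈? S | v ∈? S
      ... | no u∉S | _ = inj₁ (x∈p∪q⁺ (inj₂ (x∈p∩q⁺ (~⇒∈V u~v , x∉p⇒x∈∁p u∉S))))
      ... | yes _ | no v∉S = inj₂ (x∈p∪q⁺ (inj₂ (x∈p∩q⁺ (~⇒∈V (~-sym u~v) , x∉p⇒x∈∁p v∉S))))
      ... | yes u∈S | yes v∈S =
        [ inj₁ ∘ x∈p∪q⁺ ∘ inj₁ , inj₂ ∘ x∈p∪q⁺ ∘ inj₁ ]′ (cover u v (u~v , u∈S , v∈S))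
    x : Element (𝒱𝒞 G)
    x = (Y ∪ (V ∩ ∁ S)) ▸ [ extended p ]
    f∉V∖S : ∀ {f} → f ∈ S → f ∉ V ∩ ∁ S
    f∉V∖S f∈S f∈ = x∈∁p⇒x∉p (proj₂ (x∈p∩q⁻ V (∁ S) f∈)) f∈S
    eq : ∀ f → χ (restrict S x) f ≡ χ y f
    eq f with f ∈? S
    ... | no f∉S = trans (χ-restrict-∉ x f∉S)
            (sym (χ-outside (𝒱𝒞 (G ⟦ S ⟧)) y (f∉S ∘ proj₂ ∘ x∈p∩q⁻ V S)))
    ... | yes f∈S = trans (χ-restrict-∈ x f∈S) (lookup-⇔
            (λ f∈ → [ id , (λ f∈V∖S → contradiction f∈V∖S (f∉V∖S f∈S)) ]′ (x∈p∪q⁻ Y _ f∈))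
            (x∈p∪q⁺ ∘ inj₁))

  restrict-toggle-∉ : ∀ {S e} → e ∉ S → ∀ x → restrict S (toggle (𝒱𝒞 G) e x) ≡ restrict S x
  restrict-toggle-∉ {S} {e} e∉S x = χ-injective eq
    where
    eq : ∀ f → χ (restrict S (toggle (𝒱𝒞 G) e x)) f ≡ χ (restrict S x) f
    eq f with f ∈? S
    ... | no f∉S = trans (χ-restrict-∉ (toggle (𝒱𝒞 G) e x) f∉S) (sym (χ-restrict-∉ x f∉S))
    ... | yes f∈S = trans (χ-restrict-∈ (toggle (𝒱𝒞 G) e x) f∈S) (trans
            (toggle-off (𝒱𝒞 G) (λ f≡e → e∉S (subst (_∈ S) f≡e f∈S)) x)
            (sym (χ-restrict-∈ x f∈S)))

  -- As `S` is closed under adjacency, `e` has the same neighbours in `G` and in `G ⟦ S ⟧`, so it is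
  -- free in `x` exactly when it is free in the restriction.
  restrict-toggle-∈ : ∀ {S} → (∀ {u v} → u ∈ S → u ~ v → v ∈ S) →
    ∀ {e} → e ∈ V → e ∈ S → ∀ x →
    restrict S (toggle (𝒱𝒞 G) e x) ≡ toggle (𝒱𝒞 (G ⟦ S ⟧)) e (restrict S x)
  restrict-toggle-∈ {S} closed {e} e∈V e∈S x with VertexCovers.free? G x e
  ... | no ¬free = trans (cong (restrict S) (VertexCovers.toggle-stuck G x ¬free))
          (sym (VertexCovers.toggle-stuck (G ⟦ S ⟧) (restrict S x) λ free → ¬free λ f f~e →
            let f∈S = closed e∈S (~-sym f~e) in
            trans (sym (χ-restrict-∈ x f∈S)) (free f (f~e , f∈S , e∈S))))
  ... | yes free = χ-injective eq
    where
    free′ : VertexCovers.Free (G ⟦ S ⟧) (restrict S x) e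
    free′ f (f~e , f∈S , _) = trans (χ-restrict-∈ x f∈S) (free f f~e)
    eq : ∀ f → χ (restrict S (toggle (𝒱𝒞 G) e x)) f ≡ χ (toggle (𝒱𝒞 (G ⟦ S ⟧)) e (restrict S x)) f
    eq f with f Fin.≟ e
    ... | yes refl = trans (χ-restrict-∈ (toggle (𝒱𝒞 G) e x) e∈S)
            (trans (VertexCovers.toggle-free G e∈V x free) (trans (cong not (sym (χ-restrict-∈ x e∈S)))
            (sym (VertexCovers.toggle-free (G ⟦ S ⟧) (x∈p∩q⁺ (e∈V , e∈S)) (restrict S x) free′))))
    ... | no f≢e = trans (χ-restrict S (toggle (𝒱𝒞 G) e x) f)
            (trans (cong (_∧ lookup S f) (toggle-off (𝒱𝒞 G) f≢e x))
            (trans (sym (χ-restrict S x f)) (sym (toggle-off (𝒱𝒞 (G ⟦ S ⟧)) f≢e (restrict S x)))))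

-- The toggle group as a product over the components

module _ (G : Graph n) {k : ℕ} (C : Fin k → Subset n) (components : Components G C) where
  open Graph G using (V; _~_; ~-sym; ~⇒∈V)
  open Components components
  open Family using (Element)
  open Restriction G
  open Equivalence using () renaming (to to forth; from to back)

  private
    𝒢 : Fin k → Graph n
    𝒢 i = G ⟦ C i ⟧

  component-closed : ∀ i {u v} → u ∈ C i → u ~ v → v ∈ C i
  component-closed i {u} {v} u∈C u~v with isComponent i
  ... | r , _ , C⇔ = back (C⇔ v) (forth (C⇔ u) u∈C ◅◅ u~v ◅ Star.ε)

  component-⊆ : ∀ {i j f} → f ∈ C i → f ∈ C j → C i ⊆ C j
  component-⊆ {i} {j} {f} f∈Ci f∈Cj {u} u∈Ci with isComponent i | isComponent j
  ... | _ , _ , Ci⇔ | _ , _ , Cj⇔ =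
    back (Cj⇔ u) (forth (Cj⇔ f) f∈Cj ◅◅ Star.reverse ~-sym (forth (Ci⇔ f) f∈Ci) ◅◅ forth (Ci⇔ u) u∈Ci)

  component-unique : ∀ {i j f} → f ∈ C i → f ∈ C j → i ≡ j
  component-unique f∈Ci f∈Cj = distinct (⊆-antisym (component-⊆ f∈Ci f∈Cj) (component-⊆ f∈Cj f∈Ci))

  -- Membership in some C i is decidable, so it suffices to refute its negation; hence
  -- reachability from f may be assumed decidable, which makes the component of f a Subset.
  component-of : ∀ {f} → f ∈ V → ∃[ i ] f ∈ C i
  component-of {f} f∈V with Fin.any? (λ i → f ∈? C i)
  ... | yes found = found
  ... | no ¬found = contradiction
    (λ reachable? → ¬found (located reachable?))
    (Fin.sequence (RawMonad.rawApplicative ¬¬-Monad) λ u → ¬¬-excluded-middle)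
    where
    located : (∀ u → Dec (Star _~_ f u)) → ∃[ i ] f ∈ C i
    located reachable? with complete {D} (f , f∈V , D⇔)
      where
      D : Subset n
      D = tabulate (does ∘ reachable?)
      D⇔ : ∀ u → u ∈ D ⇔ Star _~_ f u
      D⇔ u = mk⇔
        (λ u∈D → true⇒ (reachable? u) (trans (sym (lookup∘tabulate _ u)) ([]=⇒lookup u∈D)))
        (λ p → lookup⇒[]= u D (trans (lookup∘tabulate _ u) (dec-true (reachable? u) p)))
        where
        true⇒ : ∀ {A : Set} (A? : Dec A) → does A? ≡ true → A
        true⇒ (yes a) _ = a
    ... | i , D≡C = i , subst (f ∈_) D≡C
      (lookup⇒[]= f _ (trans (lookup∘tabulate _ f) (dec-true (reachable? f) Star.ε)))

  restrictions-injective : ∀ {x y} → (∀ i → restrict (C i) x ≡ restrict (C i) y) → x ≡ y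
  restrictions-injective {x} {y} eq = χ-injective same
    where
    same : ∀ f → χ x f ≡ χ y f
    same f with f ∈? V
    ... | no f∉V = trans (χ-outside (𝒱𝒞 G) x f∉V) (sym (χ-outside (𝒱𝒞 G) y f∉V))
    ... | yes f∈V with component-of f∈V
    ...   | i , f∈C = trans (sym (χ-restrict-∈ x f∈C))
              (trans (cong (λ z → χ z f) (eq i)) (χ-restrict-∈ y f∈C))

  private
    Restricts : ∀ i → Element (𝒱𝒞 G) ↔ Element (𝒱𝒞 G) →
                Element (𝒱𝒞 (𝒢 i)) ↔ Element (𝒱𝒞 (𝒢 i)) → Set
    Restricts i = Intertwines (restrict (C i))

  toggle-image : ∀ i {g} → IsToggle (𝒱𝒞 G) g → ∃[ h ] InT (𝒱𝒞 (𝒢 i)) h × Restricts i g h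
  toggle-image i (e , e∈V , refl) with e ∈? C i
  ... | no e∉C = Group.ε (𝔖 _) , unit , restrict-toggle-∉ e∉C
  ... | yes e∈C = t (𝒱𝒞 (𝒢 i)) e , gen (e , x∈p∩q⁺ (e∈V , e∈C) , refl) ,
          restrict-toggle-∈ (component-closed i) e∈V e∈C

  -- A toggle at a vertex of `C i` lifts to the toggle of `G` at the same vertex, which the other
  -- components do not see because they are disjoint from `C i`. Both properties survive products
  -- and inverses; this gives `Coordinates`.
  lift : ∀ i {h} → InT (𝒱𝒞 (𝒢 i)) h → ∃[ g ] InT (𝒱𝒞 G) g × Restricts i g h ×
    (∀ j → j ≢ i → Restricts j g (Group.ε (𝔖 _)))
  lift i (gen (e , e∈ , refl)) with x∈p∩q⁻ V (C i) e∈
  ... | e∈V , e∈C = t (𝒱𝒞 G) e , gen (e , e∈V , refl) ,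
    restrict-toggle-∈ (component-closed i) e∈V e∈C ,
    λ j j≢i → restrict-toggle-∉ λ e∈Cj → j≢i (component-unique e∈Cj e∈C)
  lift i unit = Group.ε (𝔖 _) , unit , (λ _ → refl) , λ _ _ _ → refl
  lift i (mul {h} p q) with lift i p | lift i q
  ... | g , g∈ , r , s | g′ , g′∈ , r′ , s′ = Group._∙_ (𝔖 _) g g′ , mul g∈ g′∈ ,
    (λ x → trans (r (to g′ x)) (cong (to h) (r′ x))) ,
    λ j j≢i x → trans (s j j≢i (to g′ x)) (s′ j j≢i x)
  lift i (inv {h} p) with lift i p
  ... | g , g∈ , r , s = Group._⁻¹ (𝔖 _) g , inv g∈ ,
    intertwines-inverse _ {g} {h} r ,
    λ j j≢i → intertwines-inverse _ {g} {Group.ε (𝔖 _)} (s j j≢i)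
  lift i (resp h≈h′ p) with lift i p
  ... | g , g∈ , r , s = g , g∈ , (λ x → trans (r x) (h≈h′ _)) , s

  toggleGroup-product : T (𝒱𝒞 G) ≅ ∏ (λ i → T (𝒱𝒞 (G ⟦ C i ⟧)))
  toggleGroup-product = ∏-isomorphism {𝒢 = T (𝒱𝒞 G)} induced
    (λ i → induced-isGroupHomomorphism i) coordinates (λ {g} {g′} → joint g g′)
    where
    module _ (i : Fin k) where
      open Induced (restrict (C i)) (restrict-surjective (C i)) (toggle-image i) public
    coordinates : Coordinates {𝒢 = T (𝒱𝒞 G)} (λ i → T (𝒱𝒞 (𝒢 i))) induced
    coordinates i (h , p) with lift i p
    ... | g , g∈ , r , s = (g , g∈) , induced-unique i (g , g∈) (h , p) r ,
      λ j j≢i → induced-unique j (g , g∈) (Group.ε (T (𝒱𝒞 (𝒢 j)))) (s j j≢i)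
    -- Equal induced permutations give images of `x` with equal restrictions to every component, and
    -- these restrictions determine a cover.
    joint : ∀ g g′ → (∀ i → Group._≈_ (T (𝒱𝒞 (𝒢 i))) (induced i g) (induced i g′)) →
      Group._≈_ (T (𝒱𝒞 G)) g g′
    joint g g′ eq x = restrictions-injective {to (proj₁ g) x} {to (proj₁ g′) x} λ i →
      trans (induced-intertwines i g x) (trans (eq i _) (sym (induced-intertwines i g′ x)))

corollary3p27 : ∀ {n : ℕ} (G : Graph n) →
    (Connected G → InT (𝒱𝒞 G) ≐ U ⊎ InT (𝒱𝒞 G) ≐ 𝔄)
    × (∀ {k : ℕ} (C : Fin k → Subset n) → Components G C →
    T (𝒱𝒞 G) ≅ ∏ (λ i → T (𝒱𝒞 (G ⟦ C i ⟧))))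
corollary3p27 G = Connectedness.connected⇒symmetric⊎alternating G , toggleGroup-product G
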